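{- Let $\mathcal{C}$ be a nondegenerate $[n,k,d]_{q^m/q}$ rank-metric code. For $0\le i\le n$ let $A_i^{\mathrm{rk}}(\mathcal{C})$ be the number of codewords of $\mathcal{C}$ of rank $i$, and let $\mathcal{C}^{\mathrm{H}}$ be any Hamming-metric code associated with $\mathcal{C}$. For every integer $j$ with $0\le j\le \frac{q^n-1}{q-1}$, the number $A_j^{\mathrm{H}}(\mathcal{C}^{\mathrm{H}})$ of codewords of $\mathcal{C}^{\mathrm{H}}$ of Hamming weight $j$ is $$A_j^{\mathrm{H}}(\mathcal{C}^{\mathrm{H}})=\begin{cases}A_i^{\mathrm{rk}}(\mathcal{C}) & \text{if } j=\frac{q^n-q^{n-i}}{q-1} \text{ for some } 0\le i\le n,\\ 0 & \text{otherwise.}\end{cases}$$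
   Context: Let $q$ be a prime power and $n,m,k$ positive integers. For $v\in\mathbb{F}_{q^m}^n$ and an ordered basis $\Gamma=(\gamma_1,\dots,\gamma_m)$ of $\mathbb{F}_{q^m}$ over $\mathbb{F}_q$, let $\Gamma(v)\in\mathbb{F}_q^{n\times m}$ be the matrix with $v_i=\sum_{j}\Gamma(v)_{ij}\gamma_j$. The rank support $\sigma^{\mathrm{rk}}(v)\subseteq\mathbb{F}_q^n$ is the column space of $\Gamma(v)$ (independent of $\Gamma$), and $\mathrm{rk}(v)=\dim_{\mathbb{F}_q}\sigma^{\mathrm{rk}}(v)$. An $[n,k,d]_{q^m/q}$ code is a $k$-dimensional $\mathbb{F}_{q^m}$-subspace $\mathcal{C}\subseteq\mathbb{F}_{q^m}^n$ with minimum rank of a nonzero codeword equal to $d$; it is nondegenerate if $\sum_{v\in\mathcal{C}}\sigma^{\mathrm{rk}}(v)=\mathbb{F}_q^n$. Associated Hamming-metric code. Let $\mathcal{C}$ be a nondegenerate $[n,k]_{q^m/q}$ code, let $G\in\mathbb{F}_{q^m}^{k\times n}$ be a generator matrix (its rows form a basis of $\mathcal{C}$) and let $\mathcal{U}\subseteq\mathbb{F}_{q^m}^k$ be the $\mathbb{F}_q$-span of the columns of $G$. For a point $P=\langle w\rangle_{\mathbb{F}_{q^m}}$ of $\mathrm{PG}(k-1,q^m)$ set $\mathrm{wt}_{\mathcal{U}}(P)=\dim_{\mathbb{F}_q}(\mathcal{U}\cap\langle w\rangle_{\mathbb{F}_{q^m}})$ and $\mathrm{m}_{\mathcal{U}}(P)=\frac{q^{\mathrm{wt}_{\mathcal{U}}(P)}-1}{q-1}$.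 One has $\sum_P \mathrm{m}_{\mathcal{U}}(P)=\frac{q^n-1}{q-1}$. Let $G_{\mathrm{Ext}}$ be a $k\times\frac{q^n-1}{q-1}$ matrix over $\mathbb{F}_{q^m}$ whose columns are, in some order, nonzero representative vectors of the points $P$, each point $P$ being represented by exactly $\mathrm{m}_{\mathcal{U}}(P)$ columns. A Hamming-metric code associated with $\mathcal{C}$, denoted $\mathcal{C}^{\mathrm{H}}$, is any code of length $\frac{q^n-1}{q-1}$ over $\mathbb{F}_{q^m}$ that is monomially equivalent to (i.e. the image under an $\mathbb{F}_{q^m}$-linear Hamming isometry of) the row space of $G_{\mathrm{Ext}}$; up to monomial equivalence it does not depend on the choices made. -}

module Defs where

open import Algebra.Apartness.Bundles using (HeytingField; HeytingCommutativeRing)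
open import Algebra.Bundles using (CommutativeRing; Ring)
open import Algebra.Module.Bundles using (LeftModule)
open import Algebra.Module.Construct.TensorUnit using () renaming (leftModule to regularModule)
open import Algebra.Module.Morphism.Structures using (module LeftModuleMorphisms)
open import Algebra.Morphism.Structures using (module RingMorphisms)
import Algebra.Properties.CommutativeMonoid.Sum as CommutativeMonoidSum
open import Data.Fin.Base using (Fin)
open import Data.Fin.Properties using (inj⇒≟)
open import Data.List.Base using (length; filter; allFin)
open import Data.Nat.Base using (ℕ; _^_; _∸_; _/_; _≤_; NonZero; >-nonZero; >-nonZero⁻¹; nonTrivial⇒nonZero; nonTrivial⇒n>1)
open import Data.Nat.Primality using (Prime)
open import Data.Nat.Properties using (m<n⇒0<n∸m; ^-monoʳ-≤; ^-identityʳ; ≤-trans; ≤-reflexive)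
open import Data.Product.Base using (∃; ∃₂; _×_; _,_; proj₁; proj₂)
open import Data.Unit.Base using (tt)
open import Data.Vec.Functional using (Vector; transpose)
open import Data.Vec.Functional.Relation.Binary.Equality.Setoid using (≋-isEquivalence)
open import Function.Bundles using (Inverse)
open import Function.Properties.Inverse using (Inverse⇒Injection)
open import Level using (Level; suc; _⊔_)
open import Relation.Binary.Bundles using (Setoid)
open import Relation.Binary.Definitions using (Decidable)
import Relation.Binary.Construct.On as On
open import Relation.Binary.PropositionalEquality as ≡ using (_≡_)
open import Relation.Nullary.Decidable using (¬?)
open import Relation.Nullary.Negation using (¬_)
open import Relation.Unary using (Pred; U; _∈_; _∩_; _≐_)

private
  variable
    a c c₁ c₂ ℓ ℓ₁ ℓ₂ m ℓm p r r₁ r₂ s : Level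

-- The elements of S satisfying P, counted up to the equality of S, number N.
HasCardinality : (S : Setoid a ℓ) → Pred (Setoid.Carrier S) p → ℕ → Set (a ⊔ ℓ ⊔ p)
HasCardinality S P N = Inverse (On.setoid S (proj₁ {B = P})) (≡.setoid (Fin N))

record PrimePower (q : ℕ) : Set where
  field
    base exponent    : ℕ
    prime            : Prime base
    .{{exponent≢0}}  : NonZero exponent
    q≡base^exponent  : q ≡ base ^ exponent

primePower⇒q∸1≢0 : ∀ {q} → PrimePower q → NonZero (q ∸ 1)
primePower⇒q∸1≢0 record { base = b ; exponent = e ; prime = b-prime ; q≡base^exponent = ≡.refl } =
  >-nonZero (m<n⇒0<n∸m (≤-trans (nonTrivial⇒n>1 b) (≤-trans (≤-reflexive (≡.sym (^-identityʳ b))) b^1≤b^e)))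
  where
  open Prime b-prime
  instance _ = nonTrivial⇒nonZero b
  b^1≤b^e = ^-monoʳ-≤ b (>-nonZero⁻¹ e)

-- A Heyting field is nontrivial: 1# - 0# is invertible, so 1# # 0#.
record FiniteField c ℓ r (q : ℕ) : Set (suc (c ⊔ ℓ ⊔ r)) where
  field
    heytingField : HeytingField c ℓ r

  open HeytingField heytingField public using (heytingCommutativeRing)

  commutativeRing : CommutativeRing c ℓ
  commutativeRing = HeytingCommutativeRing.commutativeRing heytingCommutativeRing

  open CommutativeRing commutativeRing public

  field
    enumeration : Inverse setoid (≡.setoid (Fin q))

  infix 4 _≟_

  _≟_ : Decidable _≈_
  _≟_ = inj⇒≟ (Inverse⇒Injection enumeration)

module _ {R : Ring r ℓ} (M : LeftModule R m ℓm) where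
  private module M = LeftModule M

  power : ℕ → LeftModule R m ℓm
  power n = record
    { Carrierᴹ = Vector M.Carrierᴹ n
    ; _≈ᴹ_     = λ x y → ∀ i → x i M.≈ᴹ y i
    ; _+ᴹ_     = λ x y i → x i M.+ᴹ y i
    ; _*ₗ_     = λ s x i → s M.*ₗ x i
    ; 0ᴹ       = λ _ → M.0ᴹ
    ; -ᴹ_      = λ x i → M.-ᴹ x i
    ; isLeftModule = record
      { isLeftSemimodule = record
        { +ᴹ-isCommutativeMonoid = record
          { isMonoid = record
            { isSemigroup = record
              { isMagma = record
                { isEquivalence = ≋-isEquivalence M.≈ᴹ-setoid n
                ; ∙-cong        = λ x≈y u≈v i → M.+ᴹ-cong (x≈y i) (u≈v i)
                }
              ; assoc = λ x y z i → M.+ᴹ-assoc (x i) (y i) (z i)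
              }
            ; identity = (λ x i → M.+ᴹ-identityˡ (x i)) , (λ x i → M.+ᴹ-identityʳ (x i))
            }
          ; comm = λ x y i → M.+ᴹ-comm (x i) (y i)
          }
        ; isPreleftSemimodule = record
          { *ₗ-cong      = λ s≈t x≈y i → M.*ₗ-cong s≈t (x≈y i)
          ; *ₗ-zeroˡ     = λ x i → M.*ₗ-zeroˡ (x i)
          ; *ₗ-distribʳ  = λ x s t i → M.*ₗ-distribʳ (x i) s t
          ; *ₗ-identityˡ = λ x i → M.*ₗ-identityˡ (x i)
          ; *ₗ-assoc     = λ s t x i → M.*ₗ-assoc s t (x i)
          ; *ₗ-zeroʳ     = λ s i → M.*ₗ-zeroʳ s
          ; *ₗ-distribˡ  = λ s x y i → M.*ₗ-distribˡ s (x i) (y i)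
          }
        }
      ; -ᴹ‿cong    = λ x≈y i → M.-ᴹ‿cong (x≈y i)
      ; -ᴹ‿inverse = (λ x i → M.-ᴹ‿inverseˡ (x i)) , (λ x i → M.-ᴹ‿inverseʳ (x i))
      }
    }

module _ {R : Ring r ℓ} {S : Ring s ℓ₁} where
  private
    module R = Ring R
    module S = Ring S
    open RingMorphisms S.rawRing R.rawRing

  restrictScalars : {ι : S.Carrier → R.Carrier} → IsRingHomomorphism ι →
                    LeftModule R m ℓm → LeftModule S m ℓm
  restrictScalars {ι = ι} ι-hom M = record
    { Carrierᴹ = M.Carrierᴹ
    ; _≈ᴹ_     = M._≈ᴹ_
    ; _+ᴹ_     = M._+ᴹ_
    ; _*ₗ_     = λ s x → ι s M.*ₗ x
    ; 0ᴹ       = M.0ᴹ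
    ; -ᴹ_      = M.-ᴹ_
    ; isLeftModule = record
      { isLeftSemimodule = record
        { +ᴹ-isCommutativeMonoid = M.+ᴹ-isCommutativeMonoid
        ; isPreleftSemimodule = record
          { *ₗ-cong      = λ s≈t x≈y → M.*ₗ-cong (⟦⟧-cong s≈t) x≈y
          ; *ₗ-zeroˡ     = λ x → M.≈ᴹ-trans (M.*ₗ-cong 0#-homo M.≈ᴹ-refl) (M.*ₗ-zeroˡ x)
          ; *ₗ-distribʳ  = λ x s t → M.≈ᴹ-trans (M.*ₗ-cong (+-homo s t) M.≈ᴹ-refl) (M.*ₗ-distribʳ x (ι s) (ι t))
          ; *ₗ-identityˡ = λ x → M.≈ᴹ-trans (M.*ₗ-cong 1#-homo M.≈ᴹ-refl) (M.*ₗ-identityˡ x)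
          ; *ₗ-assoc     = λ s t x → M.≈ᴹ-trans (M.*ₗ-cong (*-homo s t) M.≈ᴹ-refl) (M.*ₗ-assoc (ι s) (ι t) x)
          ; *ₗ-zeroʳ     = λ s → M.*ₗ-zeroʳ (ι s)
          ; *ₗ-distribˡ  = λ s x y → M.*ₗ-distribˡ (ι s) x y
          }
        }
      ; -ᴹ‿cong    = M.-ᴹ‿cong
      ; -ᴹ‿inverse = M.-ᴹ‿inverse
      }
    }
    where
    module M = LeftModule M
    open IsRingHomomorphism ι-hom

module LinearAlgebra {R : Ring r ℓ} (M : LeftModule R m ℓm) where
  private module R = Ring R
  open LeftModule M
  open CommutativeMonoidSum +ᴹ-commutativeMonoid using (sum)

  linearCombination : ∀ {d} → Vector R.Carrier d → Vector Carrierᴹ d → Carrierᴹ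
  linearCombination s b = sum λ i → s i *ₗ b i

  Span : ∀ {d} → Vector Carrierᴹ d → Pred Carrierᴹ (r ⊔ ℓm)
  Span b x = ∃ λ s → linearCombination s b ≈ᴹ x

  LinearlyIndependent : ∀ {d} → Vector Carrierᴹ d → Set (r ⊔ ℓ ⊔ ℓm)
  LinearlyIndependent b = ∀ s → linearCombination s b ≈ᴹ 0ᴹ → ∀ i → s i R.≈ R.0#

  -- b is a basis of P; in particular P is a submodule.
  IsBasis : ∀ {d} → Vector Carrierᴹ d → Pred Carrierᴹ p → Set (r ⊔ ℓ ⊔ m ⊔ ℓm ⊔ p)
  IsBasis b P = LinearlyIndependent b × P ≐ Span b

  HasDimension : Pred Carrierᴹ p → ℕ → Set (r ⊔ ℓ ⊔ m ⊔ ℓm ⊔ p)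
  HasDimension P d = ∃ λ (b : Vector Carrierᴹ d) → IsBasis b P

-- The sum of the subspaces V i for i in I: all finite sums of elements of these subspaces.
SumOfSubspaces : ∀ {x} {X : Set x} {R : Ring r ℓ} (M : LeftModule R m ℓm) →
                 Pred X p → (X → Pred (LeftModule.Carrierᴹ M) s) →
                 Pred (LeftModule.Carrierᴹ M) (x ⊔ m ⊔ ℓm ⊔ p ⊔ s)
SumOfSubspaces {X = X} M I V x =
  ∃ λ t → ∃₂ λ (is : Vector X t) (y : Vector Carrierᴹ t) →
    (∀ j → is j ∈ I × y j ∈ V (is j)) × sum y ≈ᴹ x
  where
  open LeftModule M
  open CommutativeMonoidSum +ᴹ-commutativeMonoid using (sum)

-- L as an extension of F, together with an ordered basis Γ of L over F.
record FieldExtension {q q′} (F : FiniteField c₁ ℓ₁ r₁ q) (L : FiniteField c₂ ℓ₂ r₂ q′) (m : ℕ)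
                      : Set (c₁ ⊔ ℓ₁ ⊔ c₂ ⊔ ℓ₂) where
  private
    module F = FiniteField F
    module L = FiniteField L
    open RingMorphisms F.rawRing L.rawRing

  field
    ι                  : F.Carrier → L.Carrier
    isRingMonomorphism : IsRingMonomorphism ι

  open IsRingMonomorphism isRingMonomorphism public using (isRingHomomorphism)

  L/F : LeftModule F.ring c₂ ℓ₂
  L/F = restrictScalars isRingHomomorphism (regularModule {R = L.ring})

  field
    Γ       : Vector L.Carrier m
    Γ-basis : LinearAlgebra.IsBasis L/F Γ U

module RankMetric {q m : ℕ} (q-primePower : PrimePower q)
                  {F : FiniteField c₁ ℓ₁ r₁ q} {L : FiniteField c₂ ℓ₂ r₂ (q ^ m)}
                  (E : FieldExtension F L m) where
  private
    module F = FiniteField F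
    module L = FiniteField L
  open FieldExtension E

  infixl 7 _/[q-1]

  _/[q-1] : ℕ → ℕ
  x /[q-1] = _/_ x (q ∸ 1) {{primePower⇒q∸1≢0 q-primePower}}

  F^ : ℕ → LeftModule F.ring c₁ ℓ₁
  F^ = power regularModule

  L^ : ℕ → LeftModule L.ring c₂ ℓ₂
  L^ = power regularModule

  -- L^ k as a vector space over F.
  L^_/F : ℕ → LeftModule F.ring c₂ ℓ₂
  L^ k /F = restrictScalars isRingHomomorphism (L^ k)

  -- The matrix Γ(v): row i consists of the coordinates of v i in the basis Γ.
  Γ⟨_⟩ : ∀ {n} → Vector L.Carrier n → Vector (Vector F.Carrier m) n
  Γ⟨ v ⟩ i = proj₁ (proj₁ (proj₂ Γ-basis) {v i} tt)

  σʳᵏ : ∀ {n} → Vector L.Carrier n → Pred (Vector F.Carrier n) (c₁ ⊔ ℓ₁)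
  σʳᵏ {n} v = LinearAlgebra.Span (F^ n) (transpose Γ⟨ v ⟩)

  HasRank : ∀ {n} → Vector L.Carrier n → ℕ → Set (c₁ ⊔ ℓ₁)
  HasRank {n} v r = LinearAlgebra.HasDimension (F^ n) (σʳᵏ v) r

  record IsCode {n} (C : Pred (Vector L.Carrier n) p) (k d : ℕ) : Set (c₁ ⊔ ℓ₁ ⊔ c₂ ⊔ ℓ₂ ⊔ p) where
    open LeftModule (L^ n) using (_≉ᴹ_; 0ᴹ)
    field
      dimension       : LinearAlgebra.HasDimension (L^ n) C k
      minRankAttained : ∃ λ v → v ∈ C × v ≉ᴹ 0ᴹ × HasRank v d
      minRankBound    : ∀ v → v ∈ C → v ≉ᴹ 0ᴹ → ∀ r → HasRank v r → d ≤ r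

  Nondegenerate : ∀ {n} → Pred (Vector L.Carrier n) p → Set (c₁ ⊔ ℓ₁ ⊔ c₂ ⊔ p)
  Nondegenerate {n = n} C = ∀ x → x ∈ SumOfSubspaces (F^ n) C σʳᵏ

  IsGeneratorMatrix : ∀ {n k} → Vector (Vector L.Carrier n) k → Pred (Vector L.Carrier n) p →
                      Set (c₂ ⊔ ℓ₂ ⊔ p)
  IsGeneratorMatrix {n = n} G C = LinearAlgebra.IsBasis (L^ n) G C

  𝓤 : ∀ {n k} → Vector (Vector L.Carrier n) k → Pred (Vector L.Carrier k) (c₁ ⊔ ℓ₂)
  𝓤 {k = k} G = LinearAlgebra.Span (L^ k /F) (transpose G)

  -- Points of PG(k-1, q^m) are given by nonzero representatives w; the same
  -- point is represented by w and w′ when ⟨ w ⟩ ≐ ⟨ w′ ⟩.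
  ⟨_⟩ : ∀ {k} → Vector L.Carrier k → Pred (Vector L.Carrier k) (c₂ ⊔ ℓ₂)
  ⟨_⟩ {k} w = LinearAlgebra.Span (L^ k) {d = 1} (λ _ → w)

  HasWeight : ∀ {n k} → Vector (Vector L.Carrier n) k → Vector L.Carrier k → ℕ →
              Set (c₁ ⊔ ℓ₁ ⊔ c₂ ⊔ ℓ₂)
  HasWeight {k = k} G w t = LinearAlgebra.HasDimension (L^ k /F) (𝓤 G ∩ ⟨ w ⟩) t

  record IsExtMatrix {n k} (G : Vector (Vector L.Carrier n) k)
                     (Gᴱ : Vector (Vector L.Carrier ((q ^ n ∸ 1) /[q-1])) k)
                     : Set (c₁ ⊔ ℓ₁ ⊔ c₂ ⊔ ℓ₂) where
    open LeftModule (L^ k) using (_≉ᴹ_; 0ᴹ)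
    field
      columns≉0    : ∀ j → transpose Gᴱ j ≉ᴹ 0ᴹ
      multiplicity : ∀ w → w ≉ᴹ 0ᴹ → ∀ t → HasWeight G w t →
                     HasCardinality (≡.setoid (Fin _)) (λ j → ⟨ transpose Gᴱ j ⟩ ≐ ⟨ w ⟩)
                                    ((q ^ t ∸ 1) /[q-1])

  hammingDistance : ∀ {N} → Vector L.Carrier N → Vector L.Carrier N → ℕ
  hammingDistance {N} x y = length (filter (λ i → ¬? (x i L.≟ y i)) (allFin N))

  hammingWeight : ∀ {N} → Vector L.Carrier N → ℕ
  hammingWeight x = hammingDistance x (λ _ → L.0#)

  record IsLinearIsometry {N} (φ : Vector L.Carrier N → Vector L.Carrier N) : Set (c₂ ⊔ ℓ₂) where
    open LeftModule (L^ N) using (rawLeftModule)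
    open LeftModuleMorphisms rawLeftModule rawLeftModule
    field
      linear   : IsLeftModuleHomomorphism φ
      isometry : ∀ x y → hammingDistance (φ x) (φ y) ≡ hammingDistance x y

  -- D is the image of C under a linear Hamming isometry.
  MonomiallyEquivalent : ∀ {N} → Pred (Vector L.Carrier N) p → Pred (Vector L.Carrier N) s →
                         Set (c₂ ⊔ ℓ₂ ⊔ p ⊔ s)
  MonomiallyEquivalent {N = N} C D =
    ∃ λ φ → IsLinearIsometry φ × D ≐ (λ y → ∃ λ x → x ∈ C × φ x ≈ᴹ y)
    where open LeftModule (L^ N) using (_≈ᴹ_)

  IsAssociatedHammingCode : ∀ {n} (k : ℕ) → Pred (Vector L.Carrier n) p →
                            Pred (Vector L.Carrier ((q ^ n ∸ 1) /[q-1])) s →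
                            Set (c₁ ⊔ ℓ₁ ⊔ c₂ ⊔ ℓ₂ ⊔ p ⊔ s)
  IsAssociatedHammingCode {n = n} k C Cᴴ =
    ∃₂ λ (G : Vector (Vector L.Carrier n) k) Gᴱ →
      IsGeneratorMatrix G C × IsExtMatrix G Gᴱ ×
      MonomiallyEquivalent (LinearAlgebra.Span (L^ _) Gᴱ) Cᴴ

  Aʳᵏ[_,_]≡_ : ∀ {n} → Pred (Vector L.Carrier n) p → ℕ → ℕ → Set (c₁ ⊔ ℓ₁ ⊔ c₂ ⊔ ℓ₂ ⊔ p)
  Aʳᵏ[_,_]≡_ {n = n} C i = HasCardinality ≈ᴹ-setoid (λ v → v ∈ C × HasRank v i)
    where open LeftModule (L^ n) using (≈ᴹ-setoid)

  Aᴴ[_,_]≡_ : ∀ {N} → Pred (Vector L.Carrier N) p → ℕ → ℕ → Set (c₂ ⊔ ℓ₂ ⊔ p)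
  Aᴴ[_,_]≡_ {N = N} D j = HasCardinality ≈ᴹ-setoid (λ x → x ∈ D × hammingWeight x ≡ j)
    where open LeftModule (L^ N) using (≈ᴹ-setoid)

-- Let ω be the Hamming weight of u Gᴱ and κ the number of x ∈ Fⁿ orthogonal to v = u G.
-- Two double counts give ω · (q - 1) + κ = qⁿ and κ · qʳ = qⁿ for r = rk v:
-- * Let s run over the vectors with u · s = 1. Every point off the hyperplane u^⊥ has
--   exactly one such representative, and by the definition of the multiplicities s spans
--   the point of q - 1 times as many nonzero x ∈ Fⁿ, mapped to Σ xᵢ gᵢ ∈ 𝓤, as columns of
--   Gᴱ. Here x ↦ Σ xᵢ gᵢ is injective since C is nondegenerate. So the qⁿ - κ vectors x
--   with u · Σ xᵢ gᵢ = x · v ≠ 0 correspond to (q - 1) ω.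
-- * x · v = 0 means that x is orthogonal to σʳᵏ v. The pairs (s, x) with
--   x · Σ sᵢ bᵢ = 0, for a basis b of σʳᵏ v, are counted by s and by x, using only that a
--   hyperplane of F^d has q^(d-1) elements.
-- Hence κ = qⁿ⁻ʳ, and ω = (qⁿ - qⁿ⁻ʳ) / (q - 1) determines r.

module Submission where

open import Defs
open import Algebra.Apartness.Bundles using (HeytingField)
open import Algebra.Bundles using (CommutativeRing; Ring)
open import Algebra.Module.Bundles using (LeftModule)
open import Algebra.Module.Construct.TensorUnit using () renaming (leftModule to regularModule)
open import Algebra.Module.Morphism.Structures using (module LeftModuleMorphisms)
open import Algebra.Morphism.Structures using (module RingMorphisms)
import Algebra.Properties.AbelianGroup as AbelianGroupProperties
import Algebra.Properties.CommutativeMonoid.Sum as CommutativeMonoidSum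
import Algebra.Properties.CommutativeSemigroup as CommutativeSemigroupProperties
import Algebra.Properties.Ring as RingProperties
import Algebra.Properties.Semiring.Sum as SemiringSum
open import Data.Empty using (⊥-elim)
open import Data.Fin.Base using (Fin; zero; suc; finToFun; funToFin; combine)
open import Data.Fin.Permutation using (↔⇒≡)
import Data.Fin.Properties as Fin
open import Data.List.Base using (length; filter; tabulate)
open import Data.Nat.Base as ℕ using (ℕ; zero; suc; NonZero; _^_; _∸_; _/_; _≤_)
open import Data.Nat.Divisibility using (_∣_; divides)
open import Data.Nat.DivMod using (m*n/n≡m; m/n*n≡m)
import Data.Nat.Properties as ℕ
open import Data.Product.Base using (∃; ∃₂; _×_; _,_; proj₁; proj₂)
open import Data.Vec.Functional using (Vector; []; _∷_; foldr; tail; transpose)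
open import Data.Vec.Functional.Relation.Binary.Equality.Setoid using (≋-setoid)
open import Function.Base using (_∘_)
open import Function.Bundles using (Inverse)
open import Function.Consequences.Setoid using (strictlyInverseˡ⇒inverseˡ; strictlyInverseʳ⇒inverseʳ)
import Function.Construct.Composition as Composition
import Function.Construct.Identity as Identity
import Function.Construct.Symmetry as Symmetry
open import Function.Properties.Inverse using (Inverse⇒Injection)
open import Level using (Level; _⊔_)
open import Relation.Binary.Bundles using (Setoid)
import Relation.Binary.Construct.On as On
open import Relation.Binary.Definitions using (_Respects_; tri<; tri≈; tri>)
open import Relation.Binary.PropositionalEquality as ≡ using (_≡_)
import Relation.Binary.Reasoning.Setoid as SetoidReasoning
open import Relation.Nullary.Decidable using (Dec; yes; no; map′; _×-dec_; ¬?; decidable-stable)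
open import Relation.Nullary.Negation using (¬_; contradiction)
open import Relation.Unary using (Pred; Decidable; U; _∈_; _⊆_; _≐_)

private
  module ℕ-Sum = SemiringSum ℕ.+-*-semiring

  variable
    a b c c₁ c₂ ℓ ℓ₁ ℓ₂ m ℓm p r r₁ r₂ s : Level

-- Counting in finite setoids

indicator : {P : Set p} → Dec P → ℕ
indicator (yes _) = 1
indicator (no  _) = 0

indicator-⇔ : {P : Set p} {Q : Set s} (P? : Dec P) (Q? : Dec Q) →
              (P → Q) → (Q → P) → indicator P? ≡ indicator Q?
indicator-⇔ (yes x) (yes y) f g = ≡.refl
indicator-⇔ (yes x) (no ¬y) f g = contradiction (f x) ¬y
indicator-⇔ (no ¬x) (yes y) f g = contradiction (g y) ¬x
indicator-⇔ (no ¬x) (no ¬y) f g = ≡.refl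

indicator-× : {P : Set p} {Q : Set s} (P? : Dec P) (Q? : Dec Q) →
              indicator (P? ×-dec Q?) ≡ indicator P? ℕ.* indicator Q?
indicator-× (yes _) (yes _) = ≡.refl
indicator-× (yes _) (no  _) = ≡.refl
indicator-× (no  _) Q?      = ≡.refl

indicator-¬ : {P : Set p} (P? : Dec P) → indicator (¬? P?) ℕ.+ indicator P? ≡ 1
indicator-¬ (yes _) = ≡.refl
indicator-¬ (no  _) = ≡.refl

module _ {S : Setoid a ℓ} {P : Pred (Setoid.Carrier S) p} where
  private module S = Setoid S

  cardinality-unique : ∀ {M N} → HasCardinality S P M → HasCardinality S P N → M ≡ N
  cardinality-unique e e′ = ↔⇒≡ (Composition.inverse (Symmetry.inverse e) e′)

  -- The preimages chosen by `f-onto` form the inverse. A choice may vary with the representative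
  -- and with the proof of `Q`; injectivity of `f` on `P` is what makes it respect equality.
  cardinality-image : {T : Setoid b ℓ₁} {Q : Pred (Setoid.Carrier T) s} {N : ℕ} →
                      let module T = Setoid T in
                      (f : S.Carrier → T.Carrier) →
                      (∀ {x y} → x S.≈ y → f x T.≈ f y) →
                      (∀ {x y} → x ∈ P → y ∈ P → f x T.≈ f y → x S.≈ y) →
                      (∀ {x} → x ∈ P → f x ∈ Q) →
                      (∀ {y} → y ∈ Q → ∃ λ x → x ∈ P × f x T.≈ y) →
                      HasCardinality S P N → HasCardinality T Q N
  cardinality-image {T = T} {Q} {N} f f-cong f-injective f-into f-onto e = record
    { to        = to
    ; from      = from
    ; to-cong   = λ {y} {y′} → to-cong {y} {y′}
    ; from-cong = λ { ≡.refl → T.refl }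
    ; inverse   = strictlyInverseˡ⇒inverseˡ (On.setoid T (proj₁ {B = Q})) (≡.setoid (Fin N))
                    (λ {y} {y′} → to-cong {y} {y′}) to∘from
                , strictlyInverseʳ⇒inverseʳ (On.setoid T (proj₁ {B = Q})) (≡.setoid (Fin N))
                    {f⁻¹ = from} {f = to} (λ { ≡.refl → T.refl }) from∘to
    }
    where
    module T = Setoid T
    module e = Inverse e
    preimage : ∃ Q → ∃ P
    preimage (y , y∈Q) = let x , x∈P , _ = f-onto y∈Q in x , x∈P
    f∘preimage : ∀ y → f (proj₁ (preimage y)) T.≈ proj₁ y
    f∘preimage (y , y∈Q) = proj₂ (proj₂ (f-onto y∈Q))
    to : ∃ Q → Fin N
    to y = e.to (preimage y)
    from : Fin N → ∃ Q
    from i = f (proj₁ (e.from i)) , f-into (proj₂ (e.from i))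
    to-cong : ∀ {y y′} → proj₁ y T.≈ proj₁ y′ → to y ≡ to y′
    to-cong {y} {y′} y≈y′ = e.to-cong (f-injective (proj₂ (preimage y)) (proj₂ (preimage y′))
      (T.trans (f∘preimage y) (T.trans y≈y′ (T.sym (f∘preimage y′)))))
    to∘from : ∀ i → to (from i) ≡ i
    to∘from i = e.inverseˡ (f-injective (proj₂ (preimage (from i))) (proj₂ (e.from i))
      (f∘preimage (from i)))
    from∘to : ∀ y → proj₁ (from (to y)) T.≈ proj₁ y
    from∘to y = T.trans (f-cong (e.strictlyInverseʳ (preimage y))) (f∘preimage y)

  cardinality-empty : (∀ x → ¬ x ∈ P) → HasCardinality S P 0
  cardinality-empty empty = record
    { to        = λ (x , x∈P) → contradiction x∈P (empty x)
    ; from      = λ ()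
    ; to-cong   = λ { {x , x∈P} → contradiction x∈P (empty x) }
    ; from-cong = λ { {()} }
    ; inverse   = (λ { {()} }) , λ { {x , x∈P} → contradiction x∈P (empty x) }
    }

  cardinality-singleton : ∀ {x} → x ∈ P → (∀ {y} → y ∈ P → x S.≈ y) → HasCardinality S P 1
  cardinality-singleton {x} x∈P unique = record
    { to        = λ _ → zero
    ; from      = λ _ → x , x∈P
    ; to-cong   = λ _ → ≡.refl
    ; from-cong = λ _ → S.refl
    ; inverse   = (λ { {zero} _ → ≡.refl }) , (λ { {_ , y∈P} _ → unique y∈P })
    }

cardinality-U : {S : Setoid a ℓ} {N : ℕ} → Inverse S (≡.setoid (Fin N)) → HasCardinality S U N
cardinality-U e = record
  { to        = e.to ∘ proj₁
  ; from      = λ i → e.from i , _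
  ; to-cong   = e.to-cong
  ; from-cong = e.from-cong
  ; inverse   = (λ eq → e.inverseˡ eq) , λ eq → e.inverseʳ eq
  }
  where module e = Inverse e

cardinality-Fin : ∀ {N} {P : Pred (Fin N) p} (P? : Decidable P) →
                  HasCardinality (≡.setoid (Fin N)) P (ℕ-Sum.sum (indicator ∘ P?))
cardinality-Fin {N = zero}         P? = cardinality-empty λ ()
cardinality-Fin {N = suc N} {P = P} P? = extend (P? zero) (cardinality-Fin (P? ∘ suc))
  where
  extend : ∀ {M} (P₀? : Dec (P zero)) → HasCardinality (≡.setoid (Fin N)) (P ∘ suc) M →
           HasCardinality (≡.setoid (Fin (suc N))) P (indicator P₀? ℕ.+ M)
  extend (yes P₀) e = record
    { to        = to
    ; from      = from
    ; to-cong   = λ { {zero , _} {zero , _} ≡.refl → ≡.refl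
                    ; {suc i , _} {suc _ , _} ≡.refl → ≡.cong suc (e.to-cong ≡.refl) }
    ; from-cong = λ { ≡.refl → ≡.refl }
    ; inverse   = (λ { {zero} {zero , _} _ → ≡.refl
                     ; {zero} {suc _ , _} ()
                     ; {suc k} {zero , _} ()
                     ; {suc k} {suc _ , _} eq → ≡.cong suc (e.inverseˡ (Fin.suc-injective eq)) })
                , (λ { {zero , _} ≡.refl → ≡.refl ; {suc i , _} ≡.refl → ≡.cong suc (e.inverseʳ ≡.refl) })
    }
    where
    module e = Inverse e
    to : ∃ P → Fin (suc _)
    to (zero  , _)   = zero
    to (suc i , i∈P) = suc (e.to (i , i∈P))
    from : Fin (suc _) → ∃ P
    from zero    = zero , P₀
    from (suc k) = let i , i∈P = e.from k in suc i , i∈P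
  extend (no ¬P₀) e = cardinality-image suc (≡.cong suc) (λ _ _ → Fin.suc-injective) (λ i∈P → i∈P)
    (λ { {zero} P₀ → contradiction P₀ ¬P₀ ; {suc i} i∈P → i , i∈P , ≡.refl }) e

length-filter-tabulate : ∀ {A : Set a} {P : Pred A p} (P? : Decidable P) {N} (f : Fin N → A) →
                         length (filter P? (tabulate f)) ≡ ℕ-Sum.sum (indicator ∘ P? ∘ f)
length-filter-tabulate P? {zero}  f = ≡.refl
length-filter-tabulate P? {suc N} f with P? (f zero)
... | yes _ = ≡.cong suc (length-filter-tabulate P? (f ∘ suc))
... | no  _ = length-filter-tabulate P? (f ∘ suc)

module Summation {S : Setoid a ℓ} {N : ℕ} (e : Inverse S (≡.setoid (Fin N))) where
  private
    module S = Setoid S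
    module e = Inverse e

  -- The sum runs over the representatives `e.from i`, so it is defined for any function on the
  -- carrier. Respect for equality enters when a witness or a count is transferred to all of `S`.
  ∑ : (S.Carrier → ℕ) → ℕ
  ∑ f = ℕ-Sum.sum (f ∘ e.from)

  ∑-cong : ∀ {f g} → (∀ x → f x ≡ g x) → ∑ f ≡ ∑ g
  ∑-cong f≗g = ℕ-Sum.sum-cong-≗ (f≗g ∘ e.from)

  ∑-const : ∀ c → ∑ (λ _ → c) ≡ N ℕ.* c
  ∑-const c = sum-const N
    where
    sum-const : ∀ M → ℕ-Sum.sum {M} (λ _ → c) ≡ M ℕ.* c
    sum-const zero    = ≡.refl
    sum-const (suc M) = ≡.cong (c ℕ.+_) (sum-const M)

  ∑-+ : ∀ f g → ∑ (λ x → f x ℕ.+ g x) ≡ ∑ f ℕ.+ ∑ g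
  ∑-+ f g = ℕ-Sum.∑-distrib-+ (f ∘ e.from) (g ∘ e.from)

  ∑-*ʳ : ∀ f c → ∑ (λ x → f x ℕ.* c) ≡ ∑ f ℕ.* c
  ∑-*ʳ f c = ≡.sym (ℕ-Sum.*-distribʳ-sum c (f ∘ e.from))

  count : {P : Pred S.Carrier p} → Decidable P → ℕ
  count P? = ∑ (indicator ∘ P?)

  module _ {P : Pred S.Carrier p} (P? : Decidable P) (P-resp : P Respects S._≈_) where

    any? : Dec (∃ P)
    any? = map′ (λ (i , Pi) → e.from i , Pi) (λ (x , Px) → e.to x , P-resp (S.sym (e.strictlyInverseʳ x)) Px)
                (Fin.any? (P? ∘ e.from))

    count-cardinality : HasCardinality S P (count P?)
    count-cardinality = cardinality-image e.from e.from-cong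
      (λ {i} {j} _ _ eq → ≡.trans (≡.sym (e.strictlyInverseˡ i)) (e.inverseˡ eq))
      (λ Px → Px)
      (λ {x} Px → e.to x , P-resp (S.sym (e.strictlyInverseʳ x)) Px , e.strictlyInverseʳ x)
      (cardinality-Fin (P? ∘ e.from))

    count≡0⇒empty : count P? ≡ 0 → ∀ x → ¬ P x
    count≡0⇒empty count≡0 x Px = contradiction (≡.subst Fin count≡0 (Inverse.to count-cardinality (x , Px))) λ ()

    count-unique : ∀ {M} → HasCardinality S P M → count P? ≡ M
    count-unique = cardinality-unique count-cardinality

∑-swap : {S : Setoid a ℓ} {T : Setoid b ℓ₁} {M N : ℕ}
         (e : Inverse S (≡.setoid (Fin M))) (e′ : Inverse T (≡.setoid (Fin N)))
         (f : Setoid.Carrier S → Setoid.Carrier T → ℕ) →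
         Summation.∑ e (λ x → Summation.∑ e′ (f x)) ≡ Summation.∑ e′ (λ y → Summation.∑ e (λ x → f x y))
∑-swap e e′ f = ℕ-Sum.∑-comm λ i j → f (Inverse.from e i) (Inverse.from e′ j)

vectorEnumeration : {S : Setoid a ℓ} {N : ℕ} → Inverse S (≡.setoid (Fin N)) →
                    ∀ d → Inverse (≋-setoid S d) (≡.setoid (Fin (N ^ d)))
vectorEnumeration {S = S} {N} e d = record
  { to        = to
  ; from      = from
  ; to-cong   = to-cong
  ; from-cong = λ { ≡.refl i → S.refl }
  ; inverse   = strictlyInverseˡ⇒inverseˡ (≋-setoid S d) (≡.setoid _) {f = to} {f⁻¹ = from} to-cong
                  (λ k → ≡.trans (funToFin-cong {d} (e.strictlyInverseˡ ∘ finToFun k)) (Fin.funToFin-finToFin {d} k))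
              , strictlyInverseʳ⇒inverseʳ (≋-setoid S d) (≡.setoid _) {f⁻¹ = from} {f = to} (λ { ≡.refl i → S.refl })
                  (λ x i → e.inverseʳ (Fin.finToFun-funToFin (e.to ∘ x) i))
  }
  where
  module S = Setoid S
  module e = Inverse e
  -- Functions that agree pointwise may fail to be propositionally equal, so their codes in base `N`
  -- are compared digit by digit.
  funToFin-cong : ∀ {d} {f g : Fin d → Fin N} → (∀ i → f i ≡ g i) → funToFin f ≡ funToFin g
  funToFin-cong {zero}  eq = ≡.refl
  funToFin-cong {suc d} eq = ≡.cong₂ combine (eq zero) (funToFin-cong (eq ∘ suc))
  to : Vector S.Carrier d → Fin (N ^ d)
  to x = funToFin (e.to ∘ x)
  from : Fin (N ^ d) → Vector S.Carrier d
  from k = e.from ∘ finToFun k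
  to-cong : ∀ {x y} → (∀ i → x i S.≈ y i) → to x ≡ to y
  to-cong x≈y = funToFin-cong (e.to-cong ∘ x≈y)

-- Linear algebra over finite fields

-- A sum in a power of a module folds whole vectors; here a coordinate is moved inside the fold. The
-- result is an `_≡_`, which can also be used under decision procedures such as `_≟_`.
foldr-pointwise : ∀ {A : Set a} (_⊕_ : A → A → A) (z : A) {n d} (f : Vector (Vector A n) d) i →
                  foldr (λ x y i → x i ⊕ y i) (λ _ → z) f i ≡ foldr _⊕_ z (λ j → f j i)
foldr-pointwise _⊕_ z {d = zero}  f i = ≡.refl
foldr-pointwise _⊕_ z {d = suc d} f i = ≡.cong (f zero i ⊕_) (foldr-pointwise _⊕_ z (tail f) i)

module LinearAlgebraProperties {R : Ring r ℓ} (M : LeftModule R m ℓm) where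
  private module R = Ring R
  open LeftModule M
  open LinearAlgebra M
  open CommutativeMonoidSum +ᴹ-commutativeMonoid using (sum; sum-cong-≋; ∑-distrib-+)
  open AbelianGroupProperties +ᴹ-abelianGroup using (inverseˡ-unique)
  open SetoidReasoning ≈ᴹ-setoid

  record IsSubspace (P : Pred Carrierᴹ p) : Set (r ⊔ m ⊔ ℓm ⊔ p) where
    field
      respects : P Respects _≈ᴹ_
      0ᴹ∈      : 0ᴹ ∈ P
      +ᴹ∈      : ∀ {x y} → x ∈ P → y ∈ P → x +ᴹ y ∈ P
      *ₗ∈      : ∀ {x} α → x ∈ P → α *ₗ x ∈ P

  module _ {P : Pred Carrierᴹ p} (V : IsSubspace P) where
    private module V = IsSubspace V

    subspace-sum : ∀ {d} (x : Vector Carrierᴹ d) → (∀ i → x i ∈ P) → sum x ∈ P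
    subspace-sum {zero}  x x∈P = V.0ᴹ∈
    subspace-sum {suc d} x x∈P = V.+ᴹ∈ (x∈P zero) (subspace-sum (tail x) (x∈P ∘ suc))

    Span⊆subspace : ∀ {d} (b : Vector Carrierᴹ d) → (∀ i → b i ∈ P) → Span b ⊆ P
    Span⊆subspace b b∈P (s , s≈x) = V.respects s≈x (subspace-sum (λ i → s i *ₗ b i) λ i → V.*ₗ∈ (s i) (b∈P i))

  linearCombination-cong : ∀ {d} {s t : Vector R.Carrier d} (b : Vector Carrierᴹ d) →
                           (∀ i → s i R.≈ t i) → linearCombination s b ≈ᴹ linearCombination t b
  linearCombination-cong b s≈t = sum-cong-≋ λ i → *ₗ-cong (s≈t i) ≈ᴹ-refl

  linearCombination-+ : ∀ {d} (s t : Vector R.Carrier d) (b : Vector Carrierᴹ d) →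
                        linearCombination (λ i → s i R.+ t i) b ≈ᴹ
                        linearCombination s b +ᴹ linearCombination t b
  linearCombination-+ s t b = begin
    sum (λ i → (s i R.+ t i) *ₗ b i)               ≈⟨ sum-cong-≋ (λ i → *ₗ-distribʳ (b i) (s i) (t i)) ⟩
    sum (λ i → s i *ₗ b i +ᴹ t i *ₗ b i)           ≈⟨ ∑-distrib-+ (λ i → s i *ₗ b i) (λ i → t i *ₗ b i) ⟩
    linearCombination s b +ᴹ linearCombination t b ∎

  linearCombination-* : ∀ {d} α (s : Vector R.Carrier d) (b : Vector Carrierᴹ d) →
                        linearCombination (λ i → α R.* s i) b ≈ᴹ α *ₗ linearCombination s b
  linearCombination-* {zero}  α s b = ≈ᴹ-sym (*ₗ-zeroʳ α)
  linearCombination-* {suc d} α s b = begin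
    (α R.* s zero) *ₗ b zero +ᴹ linearCombination (λ i → α R.* s (suc i)) (tail b)
      ≈⟨ +ᴹ-cong (*ₗ-assoc α (s zero) (b zero)) (linearCombination-* α (tail s) (tail b)) ⟩
    α *ₗ (s zero *ₗ b zero) +ᴹ α *ₗ linearCombination (tail s) (tail b)
      ≈⟨ *ₗ-distribˡ α _ _ ⟨
    α *ₗ linearCombination s b ∎

  linearCombination-0 : ∀ {d} (s : Vector R.Carrier d) (b : Vector Carrierᴹ d) →
                        (∀ i → s i R.≈ R.0#) → linearCombination s b ≈ᴹ 0ᴹ
  linearCombination-0 {zero}  s b s≈0 = ≈ᴹ-refl
  linearCombination-0 {suc d} s b s≈0 = begin
    s zero *ₗ b zero +ᴹ linearCombination (tail s) (tail b)
      ≈⟨ +ᴹ-cong (≈ᴹ-trans (*ₗ-cong (s≈0 zero) ≈ᴹ-refl) (*ₗ-zeroˡ _)) (linearCombination-0 (tail s) (tail b) (s≈0 ∘ suc)) ⟩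
    0ᴹ +ᴹ 0ᴹ ≈⟨ +ᴹ-identityˡ 0ᴹ ⟩
    0ᴹ       ∎

  +ᴹ-≈0⇒≈ : ∀ {x y z} → x +ᴹ z ≈ᴹ 0ᴹ → y +ᴹ z ≈ᴹ 0ᴹ → x ≈ᴹ y
  +ᴹ-≈0⇒≈ x+z≈0 y+z≈0 = ≈ᴹ-trans (inverseˡ-unique _ _ x+z≈0) (≈ᴹ-sym (inverseˡ-unique _ _ y+z≈0))

  independent⇒injective : ∀ {d} {b : Vector Carrierᴹ d} → LinearlyIndependent b → ∀ {s t} →
                          linearCombination s b ≈ᴹ linearCombination t b → ∀ i → s i R.≈ t i
  independent⇒injective {b = b} b-independent {s} {t} s≈t i =
    R.trans (inverseˡ-unique′ _ _ (b-independent (λ i → s i R.+ (R.- t i)) (begin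
      linearCombination (λ i → s i R.+ (R.- t i)) b                    ≈⟨ linearCombination-+ s (λ i → R.- t i) b ⟩
      linearCombination s b +ᴹ linearCombination (λ i → R.- t i) b     ≈⟨ +ᴹ-cong s≈t ≈ᴹ-refl ⟩
      linearCombination t b +ᴹ linearCombination (λ i → R.- t i) b     ≈⟨ linearCombination-+ t (λ i → R.- t i) b ⟨
      linearCombination (λ i → t i R.+ (R.- t i)) b                    ≈⟨ linearCombination-0 _ b (λ i → R.-‿inverseʳ (t i)) ⟩
      0ᴹ                                                               ∎) i)) (-‿involutive (t i))
    where open RingProperties R using (-‿involutive)
          open AbelianGroupProperties R.+-abelianGroup using () renaming (inverseˡ-unique to inverseˡ-unique′)

  Span-isSubspace : ∀ {d} (b : Vector Carrierᴹ d) → IsSubspace (Span b)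
  Span-isSubspace b = record
    { respects = λ x≈y (s , s≈x) → s , ≈ᴹ-trans s≈x x≈y
    ; 0ᴹ∈      = (λ _ → R.0#) , linearCombination-0 _ b (λ _ → R.refl)
    ; +ᴹ∈      = λ (s , s≈x) (t , t≈y) → (λ i → s i R.+ t i) ,
                   ≈ᴹ-trans (linearCombination-+ s t b) (+ᴹ-cong s≈x t≈y)
    ; *ₗ∈      = λ α (s , s≈x) → (λ i → α R.* s i) ,
                   ≈ᴹ-trans (linearCombination-* α s b) (*ₗ-cong R.refl s≈x)
    }

  single : ∀ {d} → Fin d → R.Carrier → Vector R.Carrier d
  single zero    α = α ∷ λ _ → R.0#
  single (suc i) α = R.0# ∷ single i α

  linearCombination-single : ∀ {d} i α (b : Vector Carrierᴹ d) →
                             linearCombination (single i α) b ≈ᴹ α *ₗ b i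
  linearCombination-single zero α b =
    ≈ᴹ-trans (+ᴹ-cong ≈ᴹ-refl (linearCombination-0 _ (tail b) (λ _ → R.refl))) (+ᴹ-identityʳ _)
  linearCombination-single (suc i) α b =
    ≈ᴹ-trans (+ᴹ-cong (*ₗ-zeroˡ _) (linearCombination-single i α (tail b))) (+ᴹ-identityˡ _)

  generator∈Span : ∀ {d} (b : Vector Carrierᴹ d) i → b i ∈ Span b
  generator∈Span b i = single i R.1# , ≈ᴹ-trans (linearCombination-single i R.1# b) (*ₗ-identityˡ (b i))

  Span-∷ : ∀ {d} x (b : Vector Carrierᴹ d) → Span b ⊆ Span (x ∷ b)
  Span-∷ x b (s , s≈y) = (R.0# ∷ s) , ≈ᴹ-trans (+ᴹ-cong (*ₗ-zeroˡ x) s≈y) (+ᴹ-identityˡ _)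

module DotProduct (R : CommutativeRing c ℓ) where
  open CommutativeRing R hiding (zero)
  open SemiringSum semiring using (sum; sum-cong-≋; ∑-comm; *-distribˡ-sum)
  open CommutativeSemigroupProperties *-commutativeSemigroup using (x∙yz≈y∙xz)
  open SetoidReasoning setoid

  private
    R^ : ℕ → LeftModule ring c ℓ
    R^ = power regularModule

  infix 7 _·_
  _·_ : ∀ {d} → Vector Carrier d → Vector Carrier d → Carrier
  _·_ = LinearAlgebra.linearCombination (regularModule {R = ring})

  ·-cong : ∀ {d} {x x′ y y′ : Vector Carrier d} → (∀ i → x i ≈ x′ i) → (∀ i → y i ≈ y′ i) → x · y ≈ x′ · y′
  ·-cong x≈x′ y≈y′ = sum-cong-≋ λ i → *-cong (x≈x′ i) (y≈y′ i)

  ·-comm : ∀ {d} (x y : Vector Carrier d) → x · y ≈ y · x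
  ·-comm x y = sum-cong-≋ λ i → *-comm (x i) (y i)

  linearCombination-lookup : ∀ {n d} (s : Vector Carrier d) (b : Vector (Vector Carrier n) d) i →
                             LinearAlgebra.linearCombination (R^ n) s b i ≡ s · (λ j → b j i)
  linearCombination-lookup s b i = foldr-pointwise _+_ 0# (λ j i → s j * b j i) i

  -- Exchange of two finite sums. It is the adjointness of a matrix and its transpose, through which
  -- conditions on vectors become conditions on their coefficients.
  ·-linearCombination : ∀ {n d} (x : Vector Carrier n) (s : Vector Carrier d) (b : Vector (Vector Carrier n) d) →
                        x · LinearAlgebra.linearCombination (R^ n) s b ≈ s · (λ j → x · b j)
  ·-linearCombination {n} {d} x s b = begin
    sum (λ l → x l * LinearAlgebra.linearCombination (R^ _) s b l)
      ≈⟨ sum-cong-≋ (λ l → *-congˡ (reflexive (linearCombination-lookup s b l))) ⟩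
    sum (λ l → x l * sum (λ j → s j * b j l))
      ≈⟨ sum-cong-≋ (λ l → *-distribˡ-sum (x l) (λ j → s j * b j l)) ⟩
    sum (λ l → sum (λ j → x l * (s j * b j l)))
      ≈⟨ ∑-comm (λ l j → x l * (s j * b j l)) ⟩
    sum (λ j → sum (λ l → x l * (s j * b j l)))
      ≈⟨ sum-cong-≋ {d} (λ j → sum-cong-≋ {n} (λ l → x∙yz≈y∙xz (x l) (s j) (b j l))) ⟩
    sum (λ j → sum (λ l → s j * (x l * b j l)))
      ≈⟨ sum-cong-≋ (λ j → *-distribˡ-sum (s j) (λ l → x l * b j l)) ⟨
    sum (λ j → s j * (x · b j)) ∎

module FiniteFieldProperties {q : ℕ} (K : FiniteField c ℓ r q) where
  open FiniteField K hiding (zero)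
  private
    module H = HeytingField heytingField
    K^ : ℕ → LeftModule ring c ℓ
    K^ = power regularModule

  1≉0 : ¬ 1# ≈ 0#
  1≉0 1≈0 = proj₂ (H.tight 1# 0#) 1≈0 (H.invertible⇒# (1# , 1-0-invertible , 1-0-invertible′))
    where
    1-0≈1 : 1# - 0# ≈ 1#
    1-0≈1 = trans (+-congˡ (RingProperties.-0#≈0# ring)) (+-identityʳ 1#)
    1-0-invertible : 1# * (1# - 0#) ≈ 1#
    1-0-invertible = trans (*-identityˡ _) 1-0≈1
    1-0-invertible′ : (1# - 0#) * 1# ≈ 1#
    1-0-invertible′ = trans (*-identityʳ _) 1-0≈1

  -- The apartness of K need not be decidable, but the search for an inverse is.
  leftInverse : ∀ {x} → ¬ x ≈ 0# → ∃ λ y → y * x ≈ 1#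
  leftInverse {x} x≉0 = decidable-stable
    (Summation.any? enumeration (λ y → y * x ≟ 1#) (λ y≈z yx≈1 → trans (*-congʳ (sym y≈z)) yx≈1))
    λ ¬inverse → x≉0 (proj₁ (H.tight x 0#) λ x#0 →
      let y , y[x-0]≈1 , _ = H.#⇒invertible x#0 in
      ¬inverse (y , trans (*-congˡ (sym (trans (+-congˡ (RingProperties.-0#≈0# ring)) (+-identityʳ x)))) y[x-0]≈1))

  ^-enumeration : ∀ d → Inverse (LeftModule.≈ᴹ-setoid (K^ d)) (≡.setoid (Fin (q ℕ.^ d)))
  ^-enumeration = vectorEnumeration enumeration

  infix 4 _≟0
  _≟0 : ∀ {d} (x : Vector Carrier d) → Dec (∀ i → x i ≈ 0#)
  x ≟0 = Fin.all? λ i → x i ≟ 0#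

  module _ (M : LeftModule ring m ℓm) {N : ℕ} (enum : Inverse (LeftModule.≈ᴹ-setoid M) (≡.setoid (Fin N))) where
    open LeftModule M
    open LinearAlgebra M
    open LinearAlgebraProperties M
    private
      module enum = Inverse enum
      module ≈ᴹ-Reasoning = SetoidReasoning ≈ᴹ-setoid

    infix 4 _≟ᴹ_
    _≟ᴹ_ : ∀ x y → Dec (x ≈ᴹ y)
    _≟ᴹ_ = Fin.inj⇒≟ (Inverse⇒Injection enum)

    Span? : ∀ {d} (b : Vector Carrierᴹ d) → Decidable (Span b)
    Span? {d} b x = Summation.any? (^-enumeration d) (λ s → linearCombination s b ≟ᴹ x)
      λ s≈t s≈x → ≈ᴹ-trans (linearCombination-cong b (λ i → sym (s≈t i))) s≈x

    ∷-independent : ∀ {d} {b : Vector Carrierᴹ d} {x} → LinearlyIndependent b → ¬ x ∈ Span b →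
                    LinearlyIndependent (x ∷ b)
    ∷-independent {d} {b} {x} b-independent x∉Span s s≈0 = λ
      { zero    → s₀≈0
      ; (suc i) → b-independent (tail s) (begin
          linearCombination (tail s) b                    ≈⟨ +ᴹ-identityˡ _ ⟨
          0ᴹ +ᴹ linearCombination (tail s) b              ≈⟨ +ᴹ-cong (≈ᴹ-trans (*ₗ-cong s₀≈0 ≈ᴹ-refl) (*ₗ-zeroˡ x)) ≈ᴹ-refl ⟨
          s zero *ₗ x +ᴹ linearCombination (tail s) b     ≈⟨ s≈0 ⟩
          0ᴹ                                              ∎) i }
      where
      open ≈ᴹ-Reasoning
      module Spanb = IsSubspace (Span-isSubspace b)
      -- If `s zero` had an inverse `α`, then `s zero *ₗ x +ᴹ y ≈ᴹ 0ᴹ`, with `y` the combination of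
      -- the tail, would give `x` as `- α` times `y`, an element of `Span b`.
      s₀≈0 : s zero ≈ 0#
      s₀≈0 = decidable-stable (s zero ≟ 0#) λ s₀≉0 →
        let α , αs₀≈1 = leftInverse s₀≉0
            y         = linearCombination (tail s) b
        in x∉Span (Spanb.respects
          (begin
            (α * - 1#) *ₗ y               ≈⟨ *ₗ-assoc α (- 1#) y ⟩
            α *ₗ (- 1# *ₗ y)              ≈⟨ *ₗ-cong refl (+ᴹ-≈0⇒≈ (begin
              - 1# *ₗ y +ᴹ y                ≈⟨ +ᴹ-cong ≈ᴹ-refl (≈ᴹ-sym (*ₗ-identityˡ y)) ⟩
              - 1# *ₗ y +ᴹ 1# *ₗ y          ≈⟨ *ₗ-distribʳ y (- 1#) 1# ⟨
              (- 1# + 1#) *ₗ y              ≈⟨ *ₗ-cong (-‿inverseˡ 1#) ≈ᴹ-refl ⟩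
              0# *ₗ y                       ≈⟨ *ₗ-zeroˡ y ⟩
              0ᴹ                            ∎) s≈0) ⟩
            α *ₗ (s zero *ₗ x)            ≈⟨ *ₗ-assoc α (s zero) x ⟨
            (α * s zero) *ₗ x             ≈⟨ *ₗ-cong αs₀≈1 ≈ᴹ-refl ⟩
            1# *ₗ x                       ≈⟨ *ₗ-identityˡ x ⟩
            x                             ∎)
          (Spanb.*ₗ∈ (α * - 1#) (tail s , ≈ᴹ-refl)))

    module _ {P : Pred Carrierᴹ p} (P? : Decidable P) where

      -- Greedy choice: the vectors of `x` are visited in turn, and one is kept if it lies in `P`
      -- and outside the span of those kept so far.
      independentFamily : ∀ {k} (x : Vector Carrierᴹ k) →
        ∃₂ λ d (b : Vector Carrierᴹ d) → LinearlyIndependent b × (∀ i → b i ∈ P) × (∀ j → x j ∈ P → x j ∈ Span b)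
      independentFamily {zero}  x = 0 , [] , (λ _ _ ()) , (λ ()) , λ ()
      independentFamily {suc k} x with independentFamily (tail x)
      ... | d , b , b-independent , b∈P , x∈Span with P? (x zero) | Span? b (x zero)
      ... | yes _    | yes x₀∈Span = d , b , b-independent , b∈P , λ { zero _ → x₀∈Span ; (suc j) → x∈Span j }
      ... | no  x₀∉P | _ = d , b , b-independent , b∈P , λ { zero x₀∈P → contradiction x₀∈P x₀∉P ; (suc j) → x∈Span j }
      ... | yes x₀∈P | no x₀∉Span = suc d , x zero ∷ b , ∷-independent b-independent x₀∉Span
        , (λ { zero → x₀∈P ; (suc i) → b∈P i })
        , λ { zero _ → generator∈Span (x zero ∷ b) zero ; (suc j) xⱼ∈P → Span-∷ (x zero) b (x∈Span j xⱼ∈P) }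

      -- The greedy choice is run on a list of all elements of the module, so the family it returns
      -- spans the whole of `P`.
      dimension-exists : IsSubspace P → ∃ (HasDimension P)
      dimension-exists V =
        let d , b , b-independent , b∈P , P⊆Span = independentFamily enum.from in
        d , b , b-independent ,
        (λ {x} x∈P → IsSubspace.respects (Span-isSubspace b) (enum.strictlyInverseʳ x)
          (P⊆Span (enum.to x) (V.respects (≈ᴹ-sym (enum.strictlyInverseʳ x)) x∈P))) ,
        Span⊆subspace V b b∈P
        where module V = IsSubspace V

    dimension⇒cardinality : ∀ {P : Pred Carrierᴹ p} {t} → HasDimension P t → HasCardinality ≈ᴹ-setoid P (q ℕ.^ t)
    dimension⇒cardinality {t = t} (b , b-independent , P⊆Span , Span⊆P) = cardinality-image
      (λ s → linearCombination s b) (linearCombination-cong b)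
      (λ _ _ → independent⇒injective b-independent) (λ {s} _ → Span⊆P (s , ≈ᴹ-refl))
      (λ x∈P → let s , s≈x = P⊆Span x∈P in s , _ , s≈x)
      (cardinality-U (^-enumeration t))

-- Counting on hyperplanes and orthogonal complements

module OrthogonalComplement {q-1 : ℕ} (K : FiniteField c ℓ r (suc q-1)) where
  open FiniteField K hiding (zero)
  open FiniteFieldProperties K
  open DotProduct commutativeRing
  private
    q = suc q-1
    K^ : ℕ → LeftModule ring c ℓ
    K^ = power regularModule
    module Regular = LinearAlgebraProperties (regularModule {R = ring})
  open Summation using (∑; count; ∑-cong; ∑-const; ∑-+; ∑-*ʳ; count-cardinality; count-unique)

  module _ {d : ℕ} (y : Vector Carrier d) where

    hyperplane? : ∀ α (x : Vector Carrier d) → Dec (x · y ≈ α)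
    hyperplane? α x = x · y ≟ α

    private
      hyperplane-respects : ∀ α {x x′ : Vector Carrier d} → (∀ i → x i ≈ x′ i) → x · y ≈ α → x′ · y ≈ α
      hyperplane-respects α x≈x′ = trans (·-cong (sym ∘ x≈x′) (λ i → refl {y i}))

    -- Translation by `α * z`, where `z · y ≈ 1#`, carries the hyperplane through the origin to the
    -- parallel one at `α`. Such a `z` is supported on a single coordinate where `y` is nonzero.
    hyperplane-translate : ¬ (∀ i → y i ≈ 0#) → ∀ α →
      count (^-enumeration d) (hyperplane? α) ≡ count (^-enumeration d) (hyperplane? 0#)
    hyperplane-translate y≉0 α = count-unique (^-enumeration d) (hyperplane? α) (hyperplane-respects α)
      (cardinality-image (translate α) (λ x≈x′ i → +-congʳ (x≈x′ i))
        (λ {x} {x′} _ _ eq i → +-cancelʳ (α * z i) (x i) (x′ i) (eq i))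
        (λ {x} x·y≈0 → trans (translate-· α x) (trans (+-congʳ x·y≈0) (+-identityˡ α)))
        (λ {x} x·y≈α → translate (- α) x ,
          trans (translate-· (- α) x) (trans (+-congʳ x·y≈α) (-‿inverseʳ α)) ,
          λ i → trans (+-assoc _ _ _) (trans (+-congˡ (trans (sym (distribʳ (z i) (- α) α))
            (trans (*-congʳ (-‿inverseˡ α)) (zeroˡ (z i))))) (+-identityʳ (x i))))
        (count-cardinality (^-enumeration d) (hyperplane? 0#) (hyperplane-respects 0#)))
      where
      open RingProperties ring using (+-cancelʳ)
      pivot = Fin.¬∀⟶∃¬ d (λ i → y i ≈ 0#) (λ i → y i ≟ 0#) y≉0
      i₀ = proj₁ pivot
      β = leftInverse (proj₂ pivot)
      z : Vector Carrier d
      z = Regular.single i₀ (proj₁ β)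
      z·y≈1 : z · y ≈ 1#
      z·y≈1 = trans (Regular.linearCombination-single i₀ (proj₁ β) y) (proj₂ β)
      translate : Carrier → Vector Carrier d → Vector Carrier d
      translate γ x i = x i + γ * z i
      translate-· : ∀ γ x → translate γ x · y ≈ x · y + γ
      translate-· γ x = begin
        translate γ x · y              ≈⟨ Regular.linearCombination-+ x (λ i → γ * z i) y ⟩
        x · y + (λ i → γ * z i) · y    ≈⟨ +-congˡ (Regular.linearCombination-* γ z y) ⟩
        x · y + γ * (z · y)            ≈⟨ +-congˡ (trans (*-congˡ z·y≈1) (*-identityʳ γ)) ⟩
        x · y + γ                      ∎
        where open SetoidReasoning setoid

    -- The count is `q ^ d` for `y` zero and one `q`-th of that otherwise. Multiplying by `q` avoids
    -- the exponent `d - 1`, and the indicator merges both cases into an expression that can be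
    -- summed over `y`.
    hyperplane-count : count (^-enumeration d) (hyperplane? 0#) ℕ.* q ≡
                       q ℕ.^ d ℕ.+ indicator (y ≟0) ℕ.* (q-1 ℕ.* q ℕ.^ d)
    hyperplane-count with y ≟0
    ... | yes y≈0 = begin
      count (^-enumeration d) (hyperplane? 0#) ℕ.* q
        ≡⟨ ≡.cong (ℕ._* q) (count-unique (^-enumeration d) (hyperplane? 0#) (hyperplane-respects 0#)
             (cardinality-image (λ x → x) (λ eq → eq) (λ _ _ eq → eq) (λ {x} _ → x·y≈0 x) (λ {x} _ → x , _ , λ i → refl)
               (cardinality-U (^-enumeration d)))) ⟩
      q ℕ.^ d ℕ.* q                          ≡⟨ ℕ.*-comm (q ℕ.^ d) q ⟩
      q ℕ.^ d ℕ.+ q-1 ℕ.* q ℕ.^ d              ≡⟨ ≡.cong (q ℕ.^ d ℕ.+_) (ℕ.*-identityˡ _) ⟨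
      q ℕ.^ d ℕ.+ 1 ℕ.* (q-1 ℕ.* q ℕ.^ d)      ∎
      where
      open ≡.≡-Reasoning
      x·y≈0 : ∀ x → x · y ≈ 0#
      x·y≈0 x = trans (·-comm x y) (Regular.linearCombination-0 y x y≈0)
    -- The `q` parallel hyperplanes have equal size, and each `x` lies on exactly one of them, the
    -- one with `α` equal to `x · y`.
    ... | no y≉0 = begin
      count (^-enumeration d) (hyperplane? 0#) ℕ.* q
        ≡⟨ ℕ.*-comm _ q ⟩
      q ℕ.* count (^-enumeration d) (hyperplane? 0#)
        ≡⟨ ∑-const enumeration _ ⟨
      ∑ enumeration (λ _ → count (^-enumeration d) (hyperplane? 0#))
        ≡⟨ ∑-cong enumeration (hyperplane-translate y≉0) ⟨
      ∑ enumeration (λ α → count (^-enumeration d) (hyperplane? α))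
        ≡⟨ ∑-swap enumeration (^-enumeration d) (λ α x → indicator (hyperplane? α x)) ⟩
      ∑ (^-enumeration d) (λ x → count enumeration (λ α → hyperplane? α x))
        ≡⟨ ∑-cong (^-enumeration d) (λ x → count-unique enumeration (λ α → hyperplane? α x) (λ α≈β → λ eq → trans eq α≈β)
             (cardinality-singleton {x = x · y} refl λ eq → eq)) ⟩
      ∑ (^-enumeration d) (λ _ → 1)
        ≡⟨ ∑-const (^-enumeration d) 1 ⟩
      q ℕ.^ d ℕ.* 1
        ≡⟨ ≡.trans (ℕ.*-identityʳ _) (≡.sym (ℕ.+-identityʳ _)) ⟩
      q ℕ.^ d ℕ.+ 0 ∎
      where open ≡.≡-Reasoning

  -- Both sides of the double count of the pairs (s, x) with x · (Σ sᵢ bᵢ) ≈ 0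
  -- are given by hyperplane-count.
  orthogonal-count : .{{_ : NonZero q-1}} → ∀ {n d} (b : Vector (Vector Carrier n) d) →
    LinearAlgebra.LinearlyIndependent (K^ n) b →
    count (^-enumeration n) (λ x → (λ i → x · b i) ≟0) ℕ.* q ℕ.^ d ≡ q ℕ.^ n
  orthogonal-count {n} {d} b b-independent =
    -- Both counts of the pairs, multiplied by `q`, contain the summand `q ^ n * q ^ d`. What
    -- remains is `q-1` times the two sides of the claim.
    ℕ.*-cancelˡ-≡ _ _ q-1 (ℕ.+-cancelˡ-≡ (q ℕ.^ n ℕ.* q ℕ.^ d) _ _ (begin
      q ℕ.^ n ℕ.* q ℕ.^ d ℕ.+ q-1 ℕ.* (κ ℕ.* q ℕ.^ d)
        ≡⟨ ≡.cong (q ℕ.^ n ℕ.* q ℕ.^ d ℕ.+_) (x∙yz≈y∙xz q-1 κ (q ℕ.^ d)) ⟩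
      q ℕ.^ n ℕ.* q ℕ.^ d ℕ.+ κ ℕ.* (q-1 ℕ.* q ℕ.^ d)
        ≡⟨ sum-of-counts (^-enumeration n) (λ x → (λ i → x · b i) ≟0) (q ℕ.^ d) (q-1 ℕ.* q ℕ.^ d)
             (λ x → count (^-enumeration d) (λ s → s · (λ i → x · b i) ≟ 0#)) (λ x → hyperplane-count (λ i → x · b i)) ⟨
      ∑ (^-enumeration n) (λ x → count (^-enumeration d) (λ s → s · (λ i → x · b i) ≟ 0#)) ℕ.* q
        ≡⟨ ≡.cong (ℕ._* q) (∑-cong (^-enumeration n) λ x → ∑-cong (^-enumeration d) λ s →
             indicator-⇔ (s · (λ i → x · b i) ≟ 0#) (x · lc s ≟ 0#)
               (trans (·-linearCombination x s b)) (trans (sym (·-linearCombination x s b)))) ⟩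
      ∑ (^-enumeration n) (λ x → count (^-enumeration d) (λ s → x · lc s ≟ 0#)) ℕ.* q
        ≡⟨ ≡.cong (ℕ._* q) (∑-swap (^-enumeration n) (^-enumeration d) λ x s → indicator (x · lc s ≟ 0#)) ⟩
      ∑ (^-enumeration d) (λ s → count (^-enumeration n) (λ x → x · lc s ≟ 0#)) ℕ.* q
        ≡⟨ sum-of-counts (^-enumeration d) (λ s → lc s ≟0) (q ℕ.^ n) (q-1 ℕ.* q ℕ.^ n)
             (λ s → count (^-enumeration n) (λ x → x · lc s ≟ 0#)) (λ s → hyperplane-count (lc s)) ⟩
      q ℕ.^ d ℕ.* q ℕ.^ n ℕ.+ count (^-enumeration d) (λ s → lc s ≟0) ℕ.* (q-1 ℕ.* q ℕ.^ n)
        ≡⟨ ≡.cong₂ ℕ._+_ (ℕ.*-comm (q ℕ.^ d) (q ℕ.^ n)) (≡.trans (≡.cong (ℕ._* (q-1 ℕ.* q ℕ.^ n)) kernel-trivial) (ℕ.*-identityˡ _)) ⟩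
      q ℕ.^ n ℕ.* q ℕ.^ d ℕ.+ q-1 ℕ.* q ℕ.^ n ∎))
    where
    open ≡.≡-Reasoning
    open CommutativeSemigroupProperties ℕ.*-commutativeSemigroup using (x∙yz≈y∙xz)
    open LinearAlgebraProperties (K^ n)
    lc : Vector Carrier d → Vector Carrier n
    lc s = LinearAlgebra.linearCombination (K^ n) s b
    κ = count (^-enumeration n) (λ x → (λ i → x · b i) ≟0)
    sum-of-counts : ∀ {a ℓ p} {S : Setoid a ℓ} {N} (e : Inverse S (≡.setoid (Fin N))) {A : Pred (Setoid.Carrier S) p}
                    (A? : Decidable A) u v (f : Setoid.Carrier S → ℕ) →
                    (∀ x → f x ℕ.* q ≡ u ℕ.+ indicator (A? x) ℕ.* v) →
                    ∑ e f ℕ.* q ≡ N ℕ.* u ℕ.+ count e A? ℕ.* v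
    sum-of-counts {N = N} e A? u v f f*q = begin
      ∑ e f ℕ.* q                                             ≡⟨ ∑-*ʳ e f q ⟨
      ∑ e (λ x → f x ℕ.* q)                                   ≡⟨ ∑-cong e f*q ⟩
      ∑ e (λ x → u ℕ.+ indicator (A? x) ℕ.* v)                ≡⟨ ∑-+ e (λ _ → u) (λ x → indicator (A? x) ℕ.* v) ⟩
      ∑ e (λ _ → u) ℕ.+ ∑ e (λ x → indicator (A? x) ℕ.* v)    ≡⟨ ≡.cong₂ ℕ._+_ (∑-const e u) (∑-*ʳ e (indicator ∘ A?) v) ⟩
      N ℕ.* u ℕ.+ count e A? ℕ.* v                            ∎
    -- By independence of `b`, only `s` equal to zero makes `lc s` vanish; it alone contributes the
    -- extra term when counting by `s`.
    kernel-trivial : count (^-enumeration d) (λ s → lc s ≟0) ≡ 1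
    kernel-trivial = count-unique (^-enumeration d) (λ s → lc s ≟0)
      (λ s≈t s≈0 i → trans (linearCombination-cong b (sym ∘ s≈t) i) (s≈0 i))
      (cardinality-singleton {x = λ _ → 0#} (linearCombination-0 _ b (λ _ → refl))
        (λ s≈0 i → sym (b-independent _ s≈0 i)))

-- Arithmetic of (qⁿ - qⁿ⁻ⁱ) / (q - 1)

module _ {q-1 : ℕ} .{{_ : NonZero q-1}} where

  private q = suc q-1

  q-1∣q^t-1 : ∀ t → q-1 ∣ q ^ t ∸ 1
  q-1∣q^t-1 t = let c , q^t≡ = geometric t in divides c (≡.cong (_∸ 1) q^t≡)
    where
    -- Here `c` is the geometric sum 1 + q + ... + q^(t-1); the form `suc (c * q-1)` keeps truncated
    -- subtraction out of the induction.
    geometric : ∀ t → ∃ λ c → q ^ t ≡ suc (c ℕ.* q-1)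
    geometric zero    = 0 , ≡.refl
    geometric (suc t) = let c , q^t≡ = geometric t in c ℕ.+ q ^ t , (begin
      q ^ t ℕ.+ q-1 ℕ.* q ^ t           ≡⟨ ≡.cong₂ ℕ._+_ q^t≡ (ℕ.*-comm q-1 (q ^ t)) ⟩
      suc (c ℕ.* q-1) ℕ.+ q ^ t ℕ.* q-1   ≡⟨ ≡.cong suc (ℕ.*-distribʳ-+ q-1 c (q ^ t)) ⟨
      suc ((c ℕ.+ q ^ t) ℕ.* q-1)       ∎)
      where open ≡.≡-Reasoning

  private
    q^[n∸r]*q^r : ∀ {n r} → r ≤ n → q ^ (n ∸ r) ℕ.* q ^ r ≡ q ^ n
    q^[n∸r]*q^r {n} {r} r≤n = ≡.trans (≡.sym (ℕ.^-distribˡ-+-* q (n ∸ r) r)) (≡.cong (q ^_) (ℕ.m∸n+n≡m r≤n))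

  -- The difference factors as `q ^ (n ∸ i)` times `q ^ i ∸ 1`.
  q-1∣q^n-q^[n-i] : ∀ {n i} → i ≤ n → q-1 ∣ q ^ n ∸ q ^ (n ∸ i)
  q-1∣q^n-q^[n-i] {n} {i} i≤n = let divides c q^i-1≡ = q-1∣q^t-1 i in divides (q ^ (n ∸ i) ℕ.* c) (begin
    q ^ n ∸ q ^ (n ∸ i)                                ≡⟨ ≡.cong₂ _∸_ (q^[n∸r]*q^r i≤n) (ℕ.*-identityʳ (q ^ (n ∸ i))) ⟨
    q ^ (n ∸ i) ℕ.* q ^ i ∸ q ^ (n ∸ i) ℕ.* 1          ≡⟨ ℕ.*-distribˡ-∸ (q ^ (n ∸ i)) (q ^ i) 1 ⟨
    q ^ (n ∸ i) ℕ.* (q ^ i ∸ 1)                        ≡⟨ ≡.cong (q ^ (n ∸ i) ℕ.*_) q^i-1≡ ⟩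
    q ^ (n ∸ i) ℕ.* (c ℕ.* q-1)                          ≡⟨ ℕ.*-assoc (q ^ (n ∸ i)) c q-1 ⟨
    q ^ (n ∸ i) ℕ.* c ℕ.* q-1                            ∎)
    where open ≡.≡-Reasoning

  private
    1<q : 1 ℕ.< q
    1<q = ℕ.s≤s (ℕ.>-nonZero⁻¹ q-1)

  ^-injective : ∀ {i j} → q ^ i ≡ q ^ j → i ≡ j
  ^-injective {i} {j} eq with ℕ.<-cmp i j
  ... | tri< i<j _ _ = contradiction eq (ℕ.<⇒≢ (ℕ.^-monoʳ-< q 1<q i<j))
  ... | tri≈ _ i≡j _ = i≡j
  ... | tri> _ _ i>j = contradiction (≡.sym eq) (ℕ.<⇒≢ (ℕ.^-monoʳ-< q 1<q i>j))

  -- As `q ^ n` is positive, so is `κ`, whence `q ^ r ≤ q ^ n`. This later bounds a rank by `n`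
  -- through counting alone, without comparing dimensions.
  factor⇒exponent≤ : ∀ κ r n → κ ℕ.* q ^ r ≡ q ^ n → r ≤ n
  factor⇒exponent≤ zero    r n eq = contradiction (≡.sym eq) (ℕ.≢-nonZero⁻¹ (q ^ n) {{ℕ.m^n≢0 q n}})
  factor⇒exponent≤ (suc κ) r n eq = ℕ.≮⇒≥ λ n<r →
    ℕ.<⇒≱ (ℕ.^-monoʳ-< q 1<q n<r) (ℕ.≤-trans (ℕ.m≤m+n _ (κ ℕ.* q ^ r)) (ℕ.≤-reflexive eq))

  factor⇒cofactor≡ : ∀ κ r n → κ ℕ.* q ^ r ≡ q ^ n → κ ≡ q ^ (n ∸ r)
  factor⇒cofactor≡ κ r n eq = ℕ.*-cancelʳ-≡ κ _ (q ^ r) {{ℕ.m^n≢0 q r}}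
    (≡.trans eq (≡.sym (q^[n∸r]*q^r (factor⇒exponent≤ κ r n eq))))

  -- The second equation identifies `κ` with `q ^ (n ∸ r)`. Subtracting it from the first leaves
  -- `ω * q-1`, so both the subtraction and the division are exact.
  weight-formula : ∀ ω κ r n → ω ℕ.* q-1 ℕ.+ κ ≡ q ^ n → κ ℕ.* q ^ r ≡ q ^ n → (q ^ n ∸ q ^ (n ∸ r)) / q-1 ≡ ω
  weight-formula ω κ r n eq₁ eq₂ = begin
    (q ^ n ∸ q ^ (n ∸ r)) / q-1       ≡⟨ ≡.cong₂ (λ x y → (x ∸ y) / q-1) eq₁ (factor⇒cofactor≡ κ r n eq₂) ⟨
    (ω ℕ.* q-1 ℕ.+ κ ∸ κ) / q-1         ≡⟨ ≡.cong (_/ q-1) (ℕ.m+n∸n≡m (ω ℕ.* q-1) κ) ⟩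
    ω ℕ.* q-1 / q-1                     ≡⟨ m*n/n≡m ω q-1 ⟩
    ω                               ∎
    where open ≡.≡-Reasoning

  -- Exact division can be undone by multiplication, and each truncated subtraction is genuine
  -- because its bounds hold; then powers of `q` determine their exponents.
  weight-injective : ∀ n {i r} → i ≤ n → r ≤ n →
    (q ^ n ∸ q ^ (n ∸ i)) / q-1 ≡ (q ^ n ∸ q ^ (n ∸ r)) / q-1 → i ≡ r
  weight-injective n {i} {r} i≤n r≤n eq =
    ℕ.∸-cancelˡ-≡ i≤n r≤n (^-injective (ℕ.∸-cancelˡ-≡ (q^[n∸_]≤q^n i) (q^[n∸_]≤q^n r) (begin
      q ^ n ∸ q ^ (n ∸ i)                  ≡⟨ m/n*n≡m (q-1∣q^n-q^[n-i] i≤n) ⟨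
      (q ^ n ∸ q ^ (n ∸ i)) / q-1 ℕ.* q-1      ≡⟨ ≡.cong (ℕ._* q-1) eq ⟩
      (q ^ n ∸ q ^ (n ∸ r)) / q-1 ℕ.* q-1      ≡⟨ m/n*n≡m (q-1∣q^n-q^[n-i] r≤n) ⟩
      q ^ n ∸ q ^ (n ∸ r)                  ∎)))
    where
    open ≡.≡-Reasoning
    q^[n∸_]≤q^n : ∀ i → q ^ (n ∸ i) ≤ q ^ n
    q^[n∸_]≤q^n i = ℕ.^-monoʳ-≤ q (ℕ.m∸n≤m n i)

-- Rank supports and associated Hamming-metric codes

module RankProperties {q-1 m : ℕ} (q-primePower : PrimePower (suc q-1))
                      {F : FiniteField c₁ ℓ₁ r₁ (suc q-1)} {L : FiniteField c₂ ℓ₂ r₂ (suc q-1 ^ m)}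
                      (E : FieldExtension F L m) where
  open RankMetric q-primePower E
  open FieldExtension E
  module F = FiniteField F
  module L = FiniteField L
  module F-Properties = FiniteFieldProperties F
  module L-Properties = FiniteFieldProperties L
  module F-Dot = DotProduct F.commutativeRing
  module L-Dot = DotProduct L.commutativeRing
  open L-Dot using (_·_)
  open Summation using (count; ∑-cong)
  private
    q = suc q-1
    module ι = RingMorphisms.IsRingHomomorphism isRingHomomorphism
    instance
      q-1≢0 : NonZero q-1
      q-1≢0 = primePower⇒q∸1≢0 q-primePower

  ι-· : ∀ {d} (x y : Vector F.Carrier d) → ι (x F-Dot.· y) L.≈ (ι ∘ x) · (ι ∘ y)
  ι-· {zero}  x y = ι.0#-homo
  ι-· {suc d} x y = L.trans (ι.+-homo _ _) (L.+-cong (ι.*-homo _ _) (ι-· (tail x) (tail y)))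

  -- Expanding every `v i` in the basis `Γ` and exchanging sums shows that the coordinates of the
  -- product are the dot products of `x` with the columns of `Γ⟨ v ⟩`. One equation over `L` thus
  -- becomes `m` equations over `F`.
  ·-Γ : ∀ {n} (x : Vector F.Carrier n) v →
        (ι ∘ x) · v L.≈ LinearAlgebra.linearCombination L/F (λ j → x F-Dot.· transpose Γ⟨ v ⟩ j) Γ
  ·-Γ x v = begin
    (ι ∘ x) · v
      ≈⟨ L-Dot.·-cong (λ i → L.refl {ι (x i)}) (λ i → L.trans (L.sym (proj₂ (proj₁ (proj₂ Γ-basis) {v i} _)))
           (L.trans (L-Dot.·-comm (ι ∘ Γ⟨ v ⟩ i) Γ) (L.reflexive (≡.sym (L-Dot.linearCombination-lookup Γ (λ j i → ι (Γ⟨ v ⟩ i j)) i))))) ⟩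
    (ι ∘ x) · LinearAlgebra.linearCombination (L^ _) Γ (λ j i → ι (Γ⟨ v ⟩ i j))
      ≈⟨ L-Dot.·-linearCombination (ι ∘ x) Γ (λ j i → ι (Γ⟨ v ⟩ i j)) ⟩
    Γ · (λ j → (ι ∘ x) · (λ i → ι (Γ⟨ v ⟩ i j)))
      ≈⟨ L-Dot.·-comm Γ _ ⟩
    (λ j → (ι ∘ x) · (λ i → ι (Γ⟨ v ⟩ i j))) · Γ
      ≈⟨ L-Dot.·-cong (λ j → ι-· x (transpose Γ⟨ v ⟩ j)) (λ j → L.refl {Γ j}) ⟨
    LinearAlgebra.linearCombination L/F (λ j → x F-Dot.· transpose Γ⟨ v ⟩ j) Γ ∎
    where open SetoidReasoning L.setoid

  orthogonal-isSubspace : ∀ {n} (x : Vector F.Carrier n) →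
                          LinearAlgebraProperties.IsSubspace (F^ n) (λ y → x F-Dot.· y F.≈ F.0#)
  orthogonal-isSubspace x = record
    { respects = λ y≈z x·y≈0 → F.trans (F-Dot.·-cong (λ i → F.refl {x i}) (λ i → F.sym (y≈z i))) x·y≈0
    ; 0ᴹ∈      = F.trans (F-Dot.·-comm x _) (linearCombination-0 _ x (λ _ → F.refl))
    ; +ᴹ∈      = λ {y} {z} x·y≈0 x·z≈0 → F.trans (F-Dot.·-comm x _) (F.trans (linearCombination-+ y z x)
                   (F.trans (F.+-cong (F.trans (F-Dot.·-comm y x) x·y≈0) (F.trans (F-Dot.·-comm z x) x·z≈0)) (F.+-identityˡ F.0#)))
    ; *ₗ∈      = λ {y} α x·y≈0 → F.trans (F-Dot.·-comm x _) (F.trans (linearCombination-* α y x)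
                   (F.trans (F.*-congˡ (F.trans (F-Dot.·-comm y x) x·y≈0)) (F.zeroʳ α)))
    }
    where open LinearAlgebraProperties (regularModule {R = F.ring})

  -- Independence of `Γ` makes `x` orthogonal to each column of `Γ⟨ v ⟩`, and the vectors orthogonal
  -- to `x` form a subspace, which therefore contains `σʳᵏ v`.
  ·≈0⇒orthogonal : ∀ {n} (x : Vector F.Carrier n) v → (ι ∘ x) · v L.≈ L.0# → ∀ {y} → y ∈ σʳᵏ v → x F-Dot.· y F.≈ F.0#
  ·≈0⇒orthogonal {n} x v x·v≈0 = LinearAlgebraProperties.Span⊆subspace (F^ n) (orthogonal-isSubspace x) (transpose Γ⟨ v ⟩)
    (proj₁ Γ-basis _ (L.trans (L.sym (·-Γ x v)) x·v≈0))

  orthogonal⇒·≈0 : ∀ {n} (x : Vector F.Carrier n) v → (∀ {y} → y ∈ σʳᵏ v → x F-Dot.· y F.≈ F.0#) → (ι ∘ x) · v L.≈ L.0#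
  orthogonal⇒·≈0 {n} x v x⊥σ = L.trans (·-Γ x v)
    (LinearAlgebraProperties.linearCombination-0 L/F _ Γ λ j →
      x⊥σ (LinearAlgebraProperties.generator∈Span (F^ n) (transpose Γ⟨ v ⟩) j))

  kernel? : ∀ {n} (v : Vector L.Carrier n) → Decidable (λ x → (ι ∘ x) · v L.≈ L.0#)
  kernel? v x = (ι ∘ x) · v L.≟ L.0#

  kernel-count : ∀ {n} → Vector L.Carrier n → ℕ
  kernel-count {n} v = count (F-Properties.^-enumeration n) (kernel? v)

  -- The kernel is the orthogonal complement of `σʳᵏ v`, and orthogonality can be tested on a basis
  -- of the support; `orthogonal-count` then applies.
  rank⇒kernel-count : ∀ {n} {v : Vector L.Carrier n} {r} → HasRank v r → kernel-count v ℕ.* q ^ r ≡ q ^ n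
  rank⇒kernel-count {n} {v} {r} (b , b-independent , σ⊆Span , Span⊆σ) = ≡.trans
    (≡.cong (ℕ._* q ^ r) (∑-cong (F-Properties.^-enumeration n) λ x →
      indicator-⇔ (kernel? v x) ((λ i → x F-Dot.· b i) F-Properties.≟0)
        (λ x·v≈0 i → ·≈0⇒orthogonal x v x·v≈0 (Span⊆σ (generator∈Span b i)))
        (λ x·b≈0 → orthogonal⇒·≈0 x v λ y∈σ → Span⊆subspace (orthogonal-isSubspace x) b x·b≈0 (σ⊆Span y∈σ))))
    (OrthogonalComplement.orthogonal-count F b b-independent)
    where open LinearAlgebraProperties (F^ n)

  -- `HasRank` is a relation, so a rank has to be exhibited before a Hamming weight can be
  -- translated into one.
  rank-exists : ∀ {n} (v : Vector L.Carrier n) → ∃ (HasRank v)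
  rank-exists {n} v = F-Properties.dimension-exists (F^ n) (F-Properties.^-enumeration n)
    (F-Properties.Span? (F^ n) (F-Properties.^-enumeration n) (transpose Γ⟨ v ⟩))
    (LinearAlgebraProperties.Span-isSubspace (F^ n) (transpose Γ⟨ v ⟩))

module AssociatedCode {q-1 m : ℕ} (q-primePower : PrimePower (suc q-1))
                      {F : FiniteField c₁ ℓ₁ r₁ (suc q-1)} {L : FiniteField c₂ ℓ₂ r₂ (suc q-1 ^ m)}
                      (E : FieldExtension F L m) where
  open RankMetric q-primePower E
  open FieldExtension E
  open RankProperties q-primePower E
  open L-Dot using (_·_; ·-cong; ·-comm; ·-linearCombination; linearCombination-lookup)
  open Summation using (∑; count; count-unique; count-cardinality; count≡0⇒empty; ∑-cong; ∑-+; ∑-*ʳ; ∑-const)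
  private
    q = suc q-1
    module F^ n = LinearAlgebraProperties (F^ n)
    module L^ n = LinearAlgebraProperties (L^ n)
    instance
      q-1≢0 : NonZero q-1
      q-1≢0 = primePower⇒q∸1≢0 q-primePower

  -- Points of projective space and their normalised representatives

  ⟨⟩? : ∀ {k} (w : Vector L.Carrier k) → Decidable ⟨ w ⟩
  ⟨⟩? {k} w = L-Properties.Span? (L^ k) (L-Properties.^-enumeration k) (λ _ → w)

  ∈⟨⟩⇒multiple : ∀ {k} {s w : Vector L.Carrier k} → s ∈ ⟨ w ⟩ → ∃ λ α → ∀ i → α L.* w i L.≈ s i
  ∈⟨⟩⇒multiple (α , α*w≈s) = α zero , λ i → L.trans (L.sym (L.+-identityʳ _)) (α*w≈s i)

  multiple∈⟨⟩ : ∀ {k} {s w : Vector L.Carrier k} α → (∀ i → α L.* w i L.≈ s i) → s ∈ ⟨ w ⟩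
  multiple∈⟨⟩ α α*w≈s = (λ _ → α) , λ i → L.trans (L.+-identityʳ _) (α*w≈s i)

  -- The scalar taking `w` to `s` cannot vanish when `s` is nonzero, so it can be inverted.
  ∈⟨⟩-sym : ∀ {k} {s w : Vector L.Carrier k} → ¬ (∀ i → s i L.≈ L.0#) → s ∈ ⟨ w ⟩ → w ∈ ⟨ s ⟩
  ∈⟨⟩-sym {s = s} {w} s≉0 s∈⟨w⟩ =
    let α , α*w≈s = ∈⟨⟩⇒multiple s∈⟨w⟩
        β , βα≈1  = L-Properties.leftInverse λ α≈0 → s≉0 λ i →
                      L.trans (L.sym (α*w≈s i)) (L.trans (L.*-congʳ α≈0) (L.zeroˡ (w i)))
    in multiple∈⟨⟩ β λ i → L.trans (L.*-congˡ (L.sym (α*w≈s i)))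
         (L.trans (L.sym (L.*-assoc β α (w i))) (L.trans (L.*-congʳ βα≈1) (L.*-identityˡ (w i))))

  ⟨⟩⊆⟨⟩ : ∀ {k} {s w : Vector L.Carrier k} → s ∈ ⟨ w ⟩ → ⟨ s ⟩ ⊆ ⟨ w ⟩
  ⟨⟩⊆⟨⟩ {k} {s} {w} s∈⟨w⟩ = L^.Span⊆subspace k (L^.Span-isSubspace k (λ _ → w)) (λ _ → s) (λ _ → s∈⟨w⟩)

  generator∈⟨⟩ : ∀ {k} (w : Vector L.Carrier k) → w ∈ ⟨ w ⟩
  generator∈⟨⟩ w = multiple∈⟨⟩ L.1# λ i → L.*-identityˡ (w i)

  ·-scale : ∀ {k} {u w s : Vector L.Carrier k} α → (∀ i → α L.* w i L.≈ s i) → u · s L.≈ α L.* (u · w)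
  ·-scale {u = u} {w} {s} α α*w≈s = begin
    u · s                   ≈⟨ ·-comm u s ⟩
    s · u                   ≈⟨ ·-cong α*w≈s (λ i → L.refl {u i}) ⟨
    (λ i → α L.* w i) · u   ≈⟨ LinearAlgebraProperties.linearCombination-* (regularModule {R = L.ring}) α w u ⟩
    α L.* (w · u)           ≈⟨ L.*-congˡ (·-comm w u) ⟩
    α L.* (u · w)           ∎
    where open SetoidReasoning L.setoid

  ∈⟨⟩-respects : ∀ {k} {w s t : Vector L.Carrier k} → (∀ i → s i L.≈ t i) → s ∈ ⟨ w ⟩ → t ∈ ⟨ w ⟩
  ∈⟨⟩-respects {k} {w} = LinearAlgebraProperties.IsSubspace.respects (L^.Span-isSubspace k (λ _ → w))

  normalised? : ∀ {k} (u w : Vector L.Carrier k) → Decidable (λ s → s ∈ ⟨ w ⟩ × u · s L.≈ L.1#)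
  normalised? u w s = ⟨⟩? w s ×-dec (u · s L.≟ L.1#)

  normalised-respects : ∀ {k} (u w : Vector L.Carrier k) {s t} → (∀ i → s i L.≈ t i) →
                        s ∈ ⟨ w ⟩ × u · s L.≈ L.1# → t ∈ ⟨ w ⟩ × u · t L.≈ L.1#
  normalised-respects u w s≈t (s∈⟨w⟩ , u·s≈1) =
    ∈⟨⟩-respects s≈t s∈⟨w⟩ , L.trans (·-cong (λ i → L.refl {u i}) (L.sym ∘ s≈t)) u·s≈1

  -- A point off the hyperplane u · s ≈ 0 has exactly one representative s with u · s ≈ 1.
  normalised-count : ∀ {k} (u w : Vector L.Carrier k) →
    count (L-Properties.^-enumeration k) (normalised? u w) ≡ indicator (¬? (u · w L.≟ L.0#))
  normalised-count {k} u w with u · w L.≟ L.0#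
  ... | yes u·w≈0 = count-unique (L-Properties.^-enumeration k) (normalised? u w) (normalised-respects u w) (cardinality-empty λ s (s∈⟨w⟩ , u·s≈1) →
    let α , α*w≈s = ∈⟨⟩⇒multiple s∈⟨w⟩ in
    L-Properties.1≉0 (L.trans (L.sym u·s≈1) (L.trans (·-scale {u = u} α α*w≈s) (L.trans (L.*-congˡ u·w≈0) (L.zeroʳ α)))))
  ... | no u·w≉0 = count-unique (L-Properties.^-enumeration k) (normalised? u w) (normalised-respects u w) (cardinality-singleton
    (multiple∈⟨⟩ β (λ i → L.refl) , L.trans (·-scale {u = u} β (λ i → L.refl)) β[u·w]≈1)
    λ (s∈⟨w⟩ , u·s≈1) i → let α , α*w≈s = ∈⟨⟩⇒multiple s∈⟨w⟩ in
      L.trans (L.*-congʳ (β≈ α (L.trans (L.sym (·-scale {u = u} α α*w≈s)) u·s≈1))) (α*w≈s i))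
    where
    open CommutativeSemigroupProperties L.*-commutativeSemigroup using (x∙yz≈y∙xz)
    β = proj₁ (L-Properties.leftInverse u·w≉0)
    β[u·w]≈1 = proj₂ (L-Properties.leftInverse u·w≉0)
    β≈ : ∀ α → α L.* (u · w) L.≈ L.1# → β L.≈ α
    β≈ α α[u·w]≈1 = L.trans (L.sym (L.*-identityʳ β)) (L.trans (L.*-congˡ (L.sym α[u·w]≈1))
      (L.trans (x∙yz≈y∙xz β α (u · w)) (L.trans (L.*-congˡ β[u·w]≈1) (L.*-identityʳ α))))

  -- Double count of the pairs of `x` and a normalised representative `s` of the point of `w x`; a
  -- vanishing `w x` contributes to neither side. The family `w` is arbitrary because both the
  -- columns of `Gᴱ` and the elements of `𝓤` are counted this way.
  count-off-hyperplane : ∀ {S : Setoid a ℓ} {N} (e : Inverse S (≡.setoid (Fin N))) {k}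
    (w : Setoid.Carrier S → Vector L.Carrier k) (u : Vector L.Carrier k) →
    count e (λ x → ¬? (u · w x L.≟ L.0#)) ≡
    ∑ (L-Properties.^-enumeration k) (λ s → count e (λ x → ⟨⟩? (w x) s) ℕ.* indicator (u · s L.≟ L.1#))
  count-off-hyperplane e {k} w u = begin
    count e (λ x → ¬? (u · w x L.≟ L.0#))
      ≡⟨ ∑-cong e (λ x → normalised-count u (w x)) ⟨
    ∑ e (λ x → ∑ L^k (λ s → indicator (normalised? u (w x) s)))
      ≡⟨ ∑-swap e L^k (λ x s → indicator (normalised? u (w x) s)) ⟩
    ∑ L^k (λ s → ∑ e (λ x → indicator (normalised? u (w x) s)))
      ≡⟨ ∑-cong L^k (λ s → ≡.trans (∑-cong e λ x → indicator-× (⟨⟩? (w x) s) (u · s L.≟ L.1#))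
                                   (∑-*ʳ e (λ x → indicator (⟨⟩? (w x) s)) (indicator (u · s L.≟ L.1#)))) ⟩
    ∑ L^k (λ s → count e (λ x → ⟨⟩? (w x) s) ℕ.* indicator (u · s L.≟ L.1#)) ∎
    where
    open ≡.≡-Reasoning
    L^k = L-Properties.^-enumeration k

  -- Hamming distance and linear isometries

  hammingDistance-count : ∀ {N} (x y : Vector L.Carrier N) →
    hammingDistance x y ≡ count (Identity.inverse (≡.setoid (Fin N))) (λ j → ¬? (x j L.≟ y j))
  hammingDistance-count x y = length-filter-tabulate (λ j → ¬? (x j L.≟ y j)) (λ j → j)

  hammingDistance-cong : ∀ {N} {x x′ y y′ : Vector L.Carrier N} → (∀ j → x j L.≈ x′ j) → (∀ j → y j L.≈ y′ j) →
                         hammingDistance x y ≡ hammingDistance x′ y′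
  hammingDistance-cong {N} {x} {x′} {y} {y′} x≈x′ y≈y′ = ≡.trans (hammingDistance-count x y) (≡.trans
    (∑-cong (Identity.inverse (≡.setoid (Fin N))) λ j → indicator-⇔ (¬? (x j L.≟ y j)) (¬? (x′ j L.≟ y′ j))
      (λ x≉y x′≈y′ → x≉y (L.trans (x≈x′ j) (L.trans x′≈y′ (L.sym (y≈y′ j)))))
      (λ x′≉y′ x≈y → x′≉y′ (L.trans (L.sym (x≈x′ j)) (L.trans x≈y (y≈y′ j)))))
    (≡.sym (hammingDistance-count x′ y′)))

  hammingDistance-refl : ∀ {N} (x : Vector L.Carrier N) → hammingDistance x x ≡ 0
  hammingDistance-refl {N} x = ≡.trans (hammingDistance-count x x)
    (count-unique (Identity.inverse (≡.setoid (Fin N))) _ (λ { ≡.refl x≉x → x≉x }) (cardinality-empty λ j x≉x → x≉x L.refl))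

  hammingDistance≡0⇒≈ : ∀ {N} (x y : Vector L.Carrier N) → hammingDistance x y ≡ 0 → ∀ j → x j L.≈ y j
  hammingDistance≡0⇒≈ {N} x y d≡0 j = decidable-stable (x j L.≟ y j)
    (count≡0⇒empty (Identity.inverse (≡.setoid (Fin N))) (λ j → ¬? (x j L.≟ y j)) (λ { ≡.refl x≉y → x≉y })
      (≡.trans (≡.sym (hammingDistance-count x y)) d≡0) j)

  isometry-weight : ∀ {N} {φ : Vector L.Carrier N → Vector L.Carrier N} → IsLinearIsometry φ →
                    ∀ x → hammingWeight (φ x) ≡ hammingWeight x
  isometry-weight {N} {φ} φ-isometry x = ≡.trans
    (hammingDistance-cong (λ j → L.refl {φ x j}) (L.sym ∘ IsLeftModuleHomomorphism.0ᴹ-homo linear)) (isometry x (λ _ → L.0#))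
    where
    open IsLinearIsometry φ-isometry
    open LeftModuleMorphisms (LeftModule.rawLeftModule (L^ N)) (LeftModule.rawLeftModule (L^ N))

  -- The parametrisation of `𝓤` by vectors over `F`

  module _ {n k} {C : Pred (Vector L.Carrier n) p} (nondegenerate : Nondegenerate C)
           {G : Vector (Vector L.Carrier n) k} (G-basis : IsGeneratorMatrix G C) where
    private
      F^n = F-Properties.^-enumeration n
      L^k = L-Properties.^-enumeration k
      module L^k/F = LinearAlgebraProperties (L^ k /F)

    codeword : Vector L.Carrier k → Vector L.Carrier n
    codeword u = LinearAlgebra.linearCombination (L^ n) u G

    point : Vector F.Carrier n → Vector L.Carrier k
    point x = LinearAlgebra.linearCombination (L^ k /F) x (transpose G)

    -- Both sides are the product of the row `u`, the matrix `G` and the column `x`. Hence `point x`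
    -- lies on the hyperplane of `u` exactly when `x` is in the kernel of the codeword of `u`.
    ·-point : ∀ u x → u · point x L.≈ (ι ∘ x) · codeword u
    ·-point u x = L.trans (·-linearCombination u (ι ∘ x) (transpose G))
      (·-cong (λ i → L.refl {ι (x i)}) (λ i → L.reflexive (≡.sym (linearCombination-lookup u G i))))

    ·-zeroʳ : ∀ {d} (u : Vector L.Carrier d) {w} → (∀ i → w i L.≈ L.0#) → u · w L.≈ L.0#
    ·-zeroʳ u {w} w≈0 = L.trans (·-comm u w) (LinearAlgebraProperties.linearCombination-0 (regularModule {R = L.ring}) w u w≈0)

    -- If `point x` vanishes, then `x` is orthogonal to every codeword and so to every rank support.
    -- By nondegeneracy each unit vector is a sum of elements of such supports, so each coordinate
    -- of `x` is zero.
    point-independent : LinearAlgebra.LinearlyIndependent (L^ k /F) (transpose G)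
    point-independent x x≈0 i =
      let t , vs , ys , ys∈ , sum≈eᵢ = nondegenerate (single i F.1#) in
      F.trans (F.sym (F.trans (F-Dot.·-comm x (single i F.1#)) (F.trans (linearCombination-single i F.1# x) (F.*-identityˡ (x i)))))
        (⊥x.respects sum≈eᵢ (F^.subspace-sum n (orthogonal-isSubspace x) ys λ j →
          ·≈0⇒orthogonal x (vs j) (x·v≈0 (proj₁ (ys∈ j))) (proj₂ (ys∈ j))))
      where
      open LinearAlgebraProperties (regularModule {R = F.ring}) using (single; linearCombination-single)
      module ⊥x = LinearAlgebraProperties.IsSubspace (orthogonal-isSubspace x)
      x·v≈0 : ∀ {v} → v ∈ C → (ι ∘ x) · v L.≈ L.0#
      x·v≈0 v∈C = let u , uG≈v = proj₁ (proj₂ G-basis) v∈C in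
        L.trans (·-cong (λ i → L.refl {ι (x i)}) (L.sym ∘ uG≈v)) (L.trans (L.sym (·-point u x)) (·-zeroʳ u x≈0))

    off-hyperplane+kernel-count : ∀ u {v} → (∀ i → codeword u i L.≈ v i) →
      count F^n (λ x → ¬? (u · point x L.≟ L.0#)) ℕ.+ kernel-count v ≡ q ^ n
    off-hyperplane+kernel-count u {v} uG≈v = begin
      count F^n (λ x → ¬? (u · point x L.≟ L.0#)) ℕ.+ kernel-count v
        ≡⟨ ≡.cong (count F^n (λ x → ¬? (u · point x L.≟ L.0#)) ℕ.+_) (∑-cong F^n λ x →
             indicator-⇔ (u · point x L.≟ L.0#) (kernel? v x) (L.trans (L.sym (u·px≈x·v x))) (L.trans (u·px≈x·v x))) ⟨
      count F^n (λ x → ¬? (u · point x L.≟ L.0#)) ℕ.+ count F^n (λ x → u · point x L.≟ L.0#)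
        ≡⟨ ∑-+ F^n (λ x → indicator (¬? (u · point x L.≟ L.0#))) (λ x → indicator (u · point x L.≟ L.0#)) ⟨
      ∑ F^n (λ x → indicator (¬? (u · point x L.≟ L.0#)) ℕ.+ indicator (u · point x L.≟ L.0#))
        ≡⟨ ∑-cong F^n (λ x → indicator-¬ (u · point x L.≟ L.0#)) ⟩
      ∑ F^n (λ _ → 1)
        ≡⟨ ≡.trans (∑-const F^n 1) (ℕ.*-identityʳ (q ^ n)) ⟩
      q ^ n ∎
      where
      open ≡.≡-Reasoning
      u·px≈x·v : ∀ x → u · point x L.≈ (ι ∘ x) · v
      u·px≈x·v x = L.trans (·-point u x) (·-cong (λ i → L.refl {ι (x i)}) uG≈v)

    -- The field `multiplicity` speaks only about a given weight of a point, so one must be found.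
    -- The intersection is a subspace over `F`, whose scalars act on `⟨ s ⟩` through `ι`.
    weight-exists : ∀ s → ∃ (HasWeight G s)
    weight-exists s = F-Properties.dimension-exists (L^ k /F) L^k
      (λ y → F-Properties.Span? (L^ k /F) L^k (transpose G) y ×-dec ⟨⟩? s y)
      (record
        { respects = λ y≈z (y∈𝓤 , y∈⟨s⟩) → 𝓤.respects y≈z y∈𝓤 , ⟨s⟩.respects y≈z y∈⟨s⟩
        ; 0ᴹ∈      = 𝓤.0ᴹ∈ , ⟨s⟩.0ᴹ∈
        ; +ᴹ∈      = λ (y∈𝓤 , y∈⟨s⟩) (z∈𝓤 , z∈⟨s⟩) → 𝓤.+ᴹ∈ y∈𝓤 z∈𝓤 , ⟨s⟩.+ᴹ∈ y∈⟨s⟩ z∈⟨s⟩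
        ; *ₗ∈      = λ α (y∈𝓤 , y∈⟨s⟩) → 𝓤.*ₗ∈ α y∈𝓤 , ⟨s⟩.*ₗ∈ (ι α) y∈⟨s⟩
        })
      where
      module 𝓤 = LinearAlgebraProperties.IsSubspace (L^k/F.Span-isSubspace (transpose G))
      module ⟨s⟩ = LinearAlgebraProperties.IsSubspace (L^.Span-isSubspace k (λ _ → s))

    -- By `point-independent`, `point` restricts to a bijection onto the intersection of `𝓤` and
    -- `⟨ s ⟩`, a space of dimension `t` over `F`.
    point-count : ∀ {s t} → HasWeight G s t → count F^n (λ x → ⟨⟩? s (point x)) ≡ q ^ t
    point-count {s} weight = cardinality-unique
      (cardinality-image point point-cong
        (λ _ _ → L^k/F.independent⇒injective point-independent)
        (λ {x} px∈⟨s⟩ → (x , λ _ → L.refl) , px∈⟨s⟩)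
        (λ ((x , px≈y) , y∈⟨s⟩) → x , ∈⟨⟩-respects (L.sym ∘ px≈y) y∈⟨s⟩ , px≈y)
        (count-cardinality F^n (λ x → ⟨⟩? s (point x)) λ x≈y → ∈⟨⟩-respects (point-cong x≈y)))
      (F-Properties.dimension⇒cardinality (L^ k /F) L^k weight)
      where
      point-cong : ∀ {x y} → (∀ i → x i F.≈ y i) → ∀ l → point x l L.≈ point y l
      point-cong = L^k/F.linearCombination-cong (transpose G)

    -- For nonzero `x` the two memberships are equivalent, `point x` being nonzero. The summand 1 is
    -- `x` equal to zero: its image lies in `⟨ s ⟩` but does not span the nonzero `s`.
    point-count-sym : ∀ {s} → ¬ (∀ i → s i L.≈ L.0#) →
      count F^n (λ x → ⟨⟩? s (point x)) ≡ 1 ℕ.+ count F^n (λ x → ⟨⟩? (point x) s)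
    point-count-sym {s} s≉0 = begin
      count F^n (λ x → ⟨⟩? s (point x))
        ≡⟨ ∑-cong F^n split ⟩
      ∑ F^n (λ x → indicator (x F-Properties.≟0) ℕ.+ indicator (⟨⟩? (point x) s))
        ≡⟨ ∑-+ F^n (λ x → indicator (x F-Properties.≟0)) (λ x → indicator (⟨⟩? (point x) s)) ⟩
      count F^n F-Properties._≟0 ℕ.+ count F^n (λ x → ⟨⟩? (point x) s)
        ≡⟨ ≡.cong (ℕ._+ count F^n (λ x → ⟨⟩? (point x) s)) (count-unique F^n F-Properties._≟0 (λ x≈y x≈0 i → F.trans (F.sym (x≈y i)) (x≈0 i))
             (cardinality-singleton {x = λ _ → F.0#} (λ _ → F.refl) (λ y≈0 i → F.sym (y≈0 i)))) ⟩
      1 ℕ.+ count F^n (λ x → ⟨⟩? (point x) s) ∎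
      where
      open ≡.≡-Reasoning
      split : ∀ x → indicator (⟨⟩? s (point x)) ≡ indicator (x F-Properties.≟0) ℕ.+ indicator (⟨⟩? (point x) s)
      split x with x F-Properties.≟0
      ... | no  x≉0 = indicator-⇔ (⟨⟩? s (point x)) (⟨⟩? (point x) s)
        (∈⟨⟩-sym λ px≈0 → x≉0 (point-independent x px≈0)) (∈⟨⟩-sym s≉0)
      ... | yes x≈0 with ⟨⟩? s (point x) | ⟨⟩? (point x) s
      ...   | yes _     | no _      = ≡.refl
      ...   | no  px∉   | _         = contradiction (∈⟨⟩-respects (L.sym ∘ L^k/F.linearCombination-0 x (transpose G) x≈0)
                                        (LinearAlgebraProperties.IsSubspace.0ᴹ∈ (L^.Span-isSubspace k (λ _ → s)))) px∉
      ...   | yes _     | yes s∈    = contradiction (λ i → let α , α*px≈s = ∈⟨⟩⇒multiple s∈ in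
        L.trans (L.sym (α*px≈s i)) (L.trans (L.*-congˡ (L^k/F.linearCombination-0 x (transpose G) x≈0 i)) (L.zeroʳ α))) s≉0

    -- Hamming weights in the row space of the extended matrix

    module _ {Gᴱ : Vector (Vector L.Carrier ((q ^ n ∸ 1) /[q-1])) k} (Gᴱ-ext : IsExtMatrix G Gᴱ) where
      open IsExtMatrix Gᴱ-ext
      private
        columns = Identity.inverse (≡.setoid (Fin ((q ^ n ∸ 1) /[q-1])))

      encodeᴱ : Vector L.Carrier k → Vector L.Carrier ((q ^ n ∸ 1) /[q-1])
      encodeᴱ u = LinearAlgebra.linearCombination (L^ _) u Gᴱ

      -- If the point of `s` has weight `t`, then `q ^ t ∸ 1` nonzero vectors `x` are mapped into
      -- it, while the multiplicity gives it `(q ^ t ∸ 1) /[q-1]` columns.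
      column-count : ∀ {s} → ¬ (∀ i → s i L.≈ L.0#) →
        count F^n (λ x → ⟨⟩? (point x) s) ≡ count columns (λ j → ⟨⟩? (transpose Gᴱ j) s) ℕ.* q-1
      column-count {s} s≉0 = let t , weight = weight-exists s in begin
        count F^n (λ x → ⟨⟩? (point x) s)
          ≡⟨ ≡.cong (_∸ 1) (≡.trans (≡.sym (point-count-sym s≉0)) (point-count weight)) ⟩
        q ^ t ∸ 1
          ≡⟨ m/n*n≡m (q-1∣q^t-1 t) ⟨
        (q ^ t ∸ 1) /[q-1] ℕ.* q-1
          ≡⟨ ≡.cong (ℕ._* q-1) (count-unique columns (λ j → ⟨⟩? (transpose Gᴱ j) s) (λ { ≡.refl s∈ → s∈ })
               -- Since `s` is nonzero, membership of `s` in the span of a column already makes the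
               -- two spans equal, which is the condition counted by `multiplicity`.
               (cardinality-image {P = λ j → ⟨ transpose Gᴱ j ⟩ ≐ ⟨ s ⟩} (λ j → j) (λ eq → eq) (λ _ _ eq → eq)
                 (λ (_ , ⟨s⟩⊆) → ⟨s⟩⊆ (generator∈⟨⟩ s))
                 (λ {j} s∈ → j , (⟨⟩⊆⟨⟩ (∈⟨⟩-sym s≉0 s∈) , ⟨⟩⊆⟨⟩ s∈) , ≡.refl)
                 (multiplicity s s≉0 t weight))) ⟨
        count columns (λ j → ⟨⟩? (transpose Gᴱ j) s) ℕ.* q-1 ∎
        where open ≡.≡-Reasoning

      -- The coordinates of `encodeᴱ u` are the products of `u` with the columns, so the weight
      -- counts columns off the hyperplane of `u`. Grouping by normalised representatives `s` lets
      -- `column-count` replace columns by vectors `x`.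
      hammingWeight-encodeᴱ : ∀ u → hammingWeight (encodeᴱ u) ℕ.* q-1 ≡ count F^n (λ x → ¬? (u · point x L.≟ L.0#))
      hammingWeight-encodeᴱ u = begin
        hammingWeight (encodeᴱ u) ℕ.* q-1
          ≡⟨ ≡.cong (ℕ._* q-1) (hammingDistance-count (encodeᴱ u) (λ _ → L.0#)) ⟩
        count columns (λ j → ¬? (encodeᴱ u j L.≟ L.0#)) ℕ.* q-1
          ≡⟨ ≡.cong (ℕ._* q-1) (∑-cong columns λ j →
               ≡.cong (λ z → indicator (¬? (z L.≟ L.0#))) (linearCombination-lookup u Gᴱ j)) ⟩
        count columns (λ j → ¬? (u · transpose Gᴱ j L.≟ L.0#)) ℕ.* q-1
          ≡⟨ ≡.cong (ℕ._* q-1) (count-off-hyperplane columns (transpose Gᴱ) u) ⟩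
        ∑ L^k (λ s → count columns (λ j → ⟨⟩? (transpose Gᴱ j) s) ℕ.* indicator (u · s L.≟ L.1#)) ℕ.* q-1
          ≡⟨ ∑-*ʳ L^k (λ s → count columns (λ j → ⟨⟩? (transpose Gᴱ j) s) ℕ.* indicator (u · s L.≟ L.1#)) q-1 ⟨
        ∑ L^k (λ s → count columns (λ j → ⟨⟩? (transpose Gᴱ j) s) ℕ.* indicator (u · s L.≟ L.1#) ℕ.* q-1)
          ≡⟨ ∑-cong L^k exchange ⟩
        ∑ L^k (λ s → count F^n (λ x → ⟨⟩? (point x) s) ℕ.* indicator (u · s L.≟ L.1#))
          ≡⟨ count-off-hyperplane F^n point u ⟨
        count F^n (λ x → ¬? (u · point x L.≟ L.0#)) ∎
        where
        open ≡.≡-Reasoning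
        exchange : ∀ s → count columns (λ j → ⟨⟩? (transpose Gᴱ j) s) ℕ.* indicator (u · s L.≟ L.1#) ℕ.* q-1 ≡
                         count F^n (λ x → ⟨⟩? (point x) s) ℕ.* indicator (u · s L.≟ L.1#)
        exchange s with u · s L.≟ L.1#
        ... | no  _     = ≡.trans (≡.cong (ℕ._* q-1) (ℕ.*-zeroʳ (count columns (λ j → ⟨⟩? (transpose Gᴱ j) s))))
                                  (≡.sym (ℕ.*-zeroʳ (count F^n (λ x → ⟨⟩? (point x) s))))
        -- A normalised `s` is nonzero, as `column-count` requires; the remaining `s` carry the
        -- factor 0.
        ... | yes u·s≈1 = ≡.trans (≡.cong (ℕ._* q-1) (ℕ.*-identityʳ (count columns (λ j → ⟨⟩? (transpose Gᴱ j) s)))) (≡.trans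
          (≡.sym (column-count λ s≈0 → L-Properties.1≉0 (L.trans (L.sym u·s≈1) (·-zeroʳ u s≈0))))
          (≡.sym (ℕ.*-identityʳ (count F^n (λ x → ⟨⟩? (point x) s)))))

      -- The codeword enters as any `v` equal to `codeword u` up to `≈`, because an element of `C`
      -- is only given with coefficients `u` in that sense.
      rank⇒hammingWeight : ∀ u {v r} → (∀ i → codeword u i L.≈ v i) → HasRank v r →
                           r ≤ n × hammingWeight (encodeᴱ u) ≡ (q ^ n ∸ q ^ (n ∸ r)) /[q-1]
      rank⇒hammingWeight u {v} {r} uG≈v rank =
        factor⇒exponent≤ (kernel-count v) r n (rank⇒kernel-count rank) ,
        ≡.sym (weight-formula (hammingWeight (encodeᴱ u)) (kernel-count v) r n
          (≡.trans (≡.cong (ℕ._+ kernel-count v) (hammingWeight-encodeᴱ u)) (off-hyperplane+kernel-count u uG≈v))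
          (rank⇒kernel-count rank))

      -- A zero word has weight 0, so no `x` has `u · point x` nonzero. Taking unit vectors for `x`
      -- shows that every coordinate of `codeword u` vanishes, and the rows of `G` are independent.
      encodeᴱ-independent : LinearAlgebra.LinearlyIndependent (L^ _) Gᴱ
      encodeᴱ-independent u uGᴱ≈0 = proj₁ G-basis u λ i →
        L.trans (L.sym (single-· i)) (L.trans (L.sym (·-point u (single i F.1#)))
          (decidable-stable (u · point (single i F.1#) L.≟ L.0#)
            (count≡0⇒empty F^n (λ x → ¬? (u · point x L.≟ L.0#)) respects count≡0 (single i F.1#))))
        where
        open LinearAlgebraProperties L/F using (single; linearCombination-single)
        respects : ∀ {x y} → (∀ i → x i F.≈ y i) → ¬ u · point x L.≈ L.0# → ¬ u · point y L.≈ L.0#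
        respects x≈y u·px≉0 u·py≈0 = u·px≉0 (L.trans (·-cong (λ l → L.refl {u l}) (L^k/F.linearCombination-cong (transpose G) x≈y)) u·py≈0)
        count≡0 : count F^n (λ x → ¬? (u · point x L.≟ L.0#)) ≡ 0
        count≡0 = ≡.trans (≡.sym (hammingWeight-encodeᴱ u)) (≡.cong (ℕ._* q-1) (≡.trans
          (hammingDistance-count (encodeᴱ u) (λ _ → L.0#))
          (count-unique columns (λ j → ¬? (encodeᴱ u j L.≟ L.0#)) (λ { ≡.refl x → x }) (cardinality-empty λ j uGᴱⱼ≉0 → uGᴱⱼ≉0 (uGᴱ≈0 j)))))
        single-· : ∀ i → (ι ∘ single i F.1#) · codeword u L.≈ codeword u i
        single-· i = L.trans (linearCombination-single i F.1# (codeword u)) (LeftModule.*ₗ-identityˡ L/F (codeword u i))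

theorem4p8 : ∀ {c₁ ℓ₁ r₁ c₂ ℓ₂ r₂ a b : Level}
    (q m n k d : ℕ) .{{_ : NonZero m}} .{{_ : NonZero n}} .{{_ : NonZero k}}
    (q-primePower : PrimePower q)
    (F : FiniteField c₁ ℓ₁ r₁ q) (L : FiniteField c₂ ℓ₂ r₂ (q ^ m)) (E : FieldExtension F L m) →
    let open RankMetric q-primePower E in
    (C : Pred (Vector (FiniteField.Carrier L) n) a) → IsCode C k d → Nondegenerate C →
    (Cᴴ : Pred (Vector (FiniteField.Carrier L) ((q ^ n ∸ 1) /[q-1])) b) → IsAssociatedHammingCode k C Cᴴ →
    (j : ℕ) → j ≤ (q ^ n ∸ 1) /[q-1] →
    ((i : ℕ) → i ≤ n → j ≡ (q ^ n ∸ q ^ (n ∸ i)) /[q-1] →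
    ∃ λ A → (Aʳᵏ[ C , i ]≡ A) × (Aᴴ[ Cᴴ , j ]≡ A))
    × (¬ (∃ λ i → i ≤ n × j ≡ (q ^ n ∸ q ^ (n ∸ i)) /[q-1]) → Aᴴ[ Cᴴ , j ]≡ 0)
-- Zero is not a prime power. Matching on `q` lets `q ∸ 1` compute to `q-1` in the remaining clause.
theorem4p8 zero _ _ _ _ q-primePower _ _ _ _ _ _ _ _ _ _ =
  ⊥-elim (NonZero.nonZero (primePower⇒q∸1≢0 q-primePower))
theorem4p8 (suc q-1) m n k d q-primePower F L E C _ nondegenerate
           Cᴴ (G , Gᴱ , G-basis , Gᴱ-ext , φ , φ-isometry , Cᴴ⊆ , ⊆Cᴴ) j _ =
  (λ i i≤n j≡ → A , rank-cardinality i≤n j≡ , hamming-cardinality) ,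
  -- A word of weight `j` would come from some `u`, and the rank of `code u` would put `j` in the
  -- excluded form.
  λ j≢ → cardinality-empty λ y (y∈Cᴴ , wt≡j) →
    let u , _ , wt-u≡j    = preimage y∈Cᴴ wt≡j
        r , rank          = rank-exists (code u)
        r≤n , wt≡         = weight u (λ _ → L.refl) rank
    in j≢ (r , r≤n , ≡.trans (≡.sym wt-u≡j) wt≡)
  where
  open RankMetric q-primePower E
  open RankProperties q-primePower E
  open AssociatedCode q-primePower E
  open IsLinearIsometry φ-isometry
  open LeftModuleMorphisms (LeftModule.rawLeftModule (L^ ((suc q-1 ^ n ∸ 1) /[q-1]))) (LeftModule.rawLeftModule (L^ _))
  module φ = IsLeftModuleHomomorphism linear
  instance
    q-1≢0 : NonZero q-1
    q-1≢0 = primePower⇒q∸1≢0 q-primePower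
  code    = codeword nondegenerate G-basis
  encode  = encodeᴱ nondegenerate G-basis Gᴱ-ext
  weight  = rank⇒hammingWeight nondegenerate G-basis Gᴱ-ext
  module L^n = LinearAlgebraProperties (L^ n)
  module L^N = LinearAlgebraProperties (L^ ((suc q-1 ^ n ∸ 1) /[q-1]))

  weight? : ∀ u → Dec (hammingWeight (encode u) ≡ j)
  weight? u = hammingWeight (encode u) ℕ.≟ j

  -- The common value counts coefficient vectors `u`. Both codes are parametrised injectively by
  -- `u`, so each of the two cardinalities is transported from this one.
  A : ℕ
  A = Summation.count (L-Properties.^-enumeration k) weight?

  A-cardinality : HasCardinality (LeftModule.≈ᴹ-setoid (L^ k)) (λ u → hammingWeight (encode u) ≡ j) A
  A-cardinality = Summation.count-cardinality (L-Properties.^-enumeration k) weight? λ u≈v wt≡j →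
    ≡.trans (hammingDistance-cong (L^N.linearCombination-cong Gᴱ λ i → L.sym (u≈v i)) (λ _ → L.refl)) wt≡j

  preimage : ∀ {y} → y ∈ Cᴴ → hammingWeight y ≡ j → ∃ λ u → (∀ l → φ (encode u) l L.≈ y l) × hammingWeight (encode u) ≡ j
  preimage y∈Cᴴ wt≡j =
    let x , (u , uGᴱ≈x) , φx≈y = Cᴴ⊆ y∈Cᴴ
        φuGᴱ≈y = λ l → L.trans (φ.⟦⟧-cong uGᴱ≈x l) (φx≈y l)
    in u , φuGᴱ≈y ,
       ≡.trans (≡.sym (isometry-weight φ-isometry (encode u))) (≡.trans (hammingDistance-cong φuGᴱ≈y (λ _ → L.refl)) wt≡j)

  hamming-cardinality : Aᴴ[ Cᴴ , j ]≡ A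
  hamming-cardinality = cardinality-image (φ ∘ encode) (λ u≈v → φ.⟦⟧-cong (L^N.linearCombination-cong Gᴱ u≈v))
    (λ {u} {v} _ _ φu≈φv → L^N.independent⇒injective (encodeᴱ-independent nondegenerate G-basis Gᴱ-ext) (φ-injective φu≈φv))
    (λ {u} wt≡j → ⊆Cᴴ (encode u , (u , λ _ → L.refl) , λ _ → L.refl) , ≡.trans (isometry-weight φ-isometry (encode u)) wt≡j)
    (λ (y∈Cᴴ , wt≡j) → let u , φuGᴱ≈y , wt-u≡j = preimage y∈Cᴴ wt≡j in u , wt-u≡j , φuGᴱ≈y)
    A-cardinality
    where
    -- An isometry preserves distance 0, and distance 0 means equality.
    φ-injective : ∀ {x y} → (∀ l → φ x l L.≈ φ y l) → ∀ l → x l L.≈ y l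
    φ-injective {x} {y} φx≈φy = hammingDistance≡0⇒≈ x y (≡.trans (≡.sym (isometry x y))
      (≡.trans (hammingDistance-cong φx≈φy (λ _ → L.refl)) (hammingDistance-refl (φ y))))

  rank-cardinality : ∀ {i} → i ≤ n → j ≡ (suc q-1 ^ n ∸ suc q-1 ^ (n ∸ i)) /[q-1] → Aʳᵏ[ C , i ]≡ A
  rank-cardinality {i} i≤n j≡ = cardinality-image code (L^n.linearCombination-cong G)
    (λ _ _ → L^n.independent⇒injective (proj₁ G-basis))
    (λ {u} wt≡j → proj₂ (proj₂ G-basis) (u , λ _ → L.refl) , hasRank wt≡j)
    (λ (v∈C , rank) → let u , uG≈v = proj₁ (proj₂ G-basis) v∈C in
      u , ≡.trans (proj₂ (weight u uG≈v rank)) (≡.sym j≡) , uG≈v)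
    A-cardinality
    where
    -- Some rank `r` exists and yields the weight formula with `r`; since the formula is injective
    -- in the rank, `r` is `i`.
    hasRank : ∀ {u} → hammingWeight (encode u) ≡ j → HasRank (code u) i
    hasRank {u} wt≡j =
      let r , rank  = rank-exists (code u)
          r≤n , wt≡ = weight u (λ _ → L.refl) rank
      in ≡.subst (HasRank (code u)) (weight-injective {q-1} n r≤n i≤n (≡.trans (≡.sym wt≡) (≡.trans wt≡j j≡))) rank
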